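{- Let $c,k$ be positive integers with $k$ odd, let $d,l,z$ be nonnegative integers, let $P(x)\in\mathbb{Z}[x]$, and let $0\le j<c$. If $n$ is an integer with $n\ge(\deg(P)+2(l+d)+1)kc$, then $$\sum_{\substack{0\le m\le n\\ m\equiv j \pmod{c}}}(-1)^{\frac{m-j}{c}} P(m)\,(q^z)^m\,\frac{d^l}{dq^l}\left[\binom{n}{m}_q\right]\equiv 0\pmod{\Phi_{kc}(q)^{d+1}}.$$
   Context: For integers $0\le m\le n$, $\binom{n}{m}_q=\frac{(1-q^n)\cdots(1-q^{n-m+1})}{(1-q^m)\cdots(1-q)}\in\mathbb{Z}[q]$ is the $q$-binomial coefficient. $\Phi_N(q)$ is the $N$-th cyclotomic polynomial, and $\frac{d^l}{dq^l}$ is the $l$-th derivative in $q$. The congruence means divisibility in $\mathbb{Z}[q]$. -}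

module Defs where

open import Data.Nat as ℕ using (ℕ; zero; suc)
open import Data.Nat.Divisibility using (_∣?_)
open import Data.Integer as ℤ using (ℤ; +_; 0ℤ; 1ℤ)
open import Data.Integer.Properties as ℤP using ()
open import Data.List using (List; []; _∷_; map; reverse; length; replicate; _++_; foldr; upTo)
open import Data.Bool using (Bool; true; false; if_then_else_)
open import Data.Product using (Σ; ∃; _×_; _,_)
open import Relation.Nullary.Decidable using (⌊_⌋)
open import Relation.Binary.PropositionalEquality using (_≡_)

-- Polynomials in ℤ[q], represented by coefficient lists, lowest degree first.
-- Trailing zeros are allowed; equality of polynomials is coefficientwise (_≈P_).
Poly : Set
Poly = List ℤ

coeff : Poly → ℕ → ℤ
coeff []       _       = 0ℤ
coeff (a ∷ f) zero    = a
coeff (a ∷ f) (suc i) = coeff f i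

_≈P_ : Poly → Poly → Set
f ≈P g = ∀ i → coeff f i ≡ coeff g i

infixl 6 _+P_ _-P_
infixl 7 _*P_

_+P_ : Poly → Poly → Poly
[]      +P g       = g
(a ∷ f) +P []      = a ∷ f
(a ∷ f) +P (b ∷ g) = (a ℤ.+ b) ∷ (f +P g)

scaleP : ℤ → Poly → Poly
scaleP a f = map (a ℤ.*_) f

negP : Poly → Poly
negP f = map ℤ.-_ f

_-P_ : Poly → Poly → Poly
f -P g = f +P negP g

_*P_ : Poly → Poly → Poly
[]      *P g = []
(a ∷ f) *P g = scaleP a g +P (0ℤ ∷ (f *P g))

oneP : Poly
oneP = 1ℤ ∷ []

shiftP : ℕ → Poly → Poly
shiftP k f = replicate k 0ℤ ++ f

qPow : ℕ → Poly
qPow k = shiftP k oneP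

_^P_ : Poly → ℕ → Poly
f ^P zero  = oneP
f ^P suc e = f *P (f ^P e)

private
  derivGo : ℕ → Poly → Poly
  derivGo i []      = []
  derivGo i (b ∷ f) = ((+ i) ℤ.* b) ∷ derivGo (suc i) f

deriv : Poly → Poly
deriv []      = []
deriv (a ∷ f) = derivGo 1 f

derivN : ℕ → Poly → Poly
derivN zero    f = f
derivN (suc l) f = deriv (derivN l f)

eval : Poly → ℤ → ℤ
eval []      x = 0ℤ
eval (a ∷ f) x = a ℤ.+ x ℤ.* eval f x

-- removal of trailing zero coefficients, and the degree
-- (degree of the zero polynomial is taken to be 0)
private
  dropZeros : List ℤ → List ℤ
  dropZeros []            = []
  dropZeros (+ zero ∷ xs) = dropZeros xs
  dropZeros (x ∷ xs)      = x ∷ xs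

normalizeP : Poly → Poly
normalizeP f = reverse (dropZeros (reverse f))

deg : Poly → ℕ
deg f = length (normalizeP f) ℕ.∸ 1

_∣P_ : Poly → Poly → Set
f ∣P g = ∃ λ h → g ≈P (f *P h)

-- q-binomial coefficient, via the q-Pascal rule
-- [n+1, m+1]_q = [n, m]_q + q^(m+1) [n, m+1]_q, [n,0]_q = 1, [0,m+1]_q = 0
qbinom : ℕ → ℕ → Poly
qbinom n       zero    = oneP
qbinom zero    (suc m) = []
qbinom (suc n) (suc m) = qbinom n m +P shiftP (suc m) (qbinom n (suc m))

-- quotient of f by a MONIC polynomial g (long division; the remainder is discarded)
private
  subPref : List ℤ → List ℤ → List ℤ
  subPref r        []       = r
  subPref []       (b ∷ bs) = ℤ.- b ∷ subPref [] bs
  subPref (x ∷ r)  (b ∷ bs) = (x ℤ.- b) ∷ subPref r bs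

  -- high-degree-first long division, gs = divisor without its leading 1
  divGo : List ℤ → ℕ → List ℤ → List ℤ
  divGo gs zero    r       = []
  divGo gs (suc k) []      = []
  divGo gs (suc k) (a ∷ r) = a ∷ divGo gs k (subPref r (map (a ℤ.*_) gs))

quotMonic : Poly → Poly → Poly
quotMonic f g with reverse (normalizeP g)
... | []      = []
... | _ ∷ gs  = reverse (divGo gs (suc (length F ℕ.∸ suc (length gs))) F)
  where F = reverse (normalizeP f)

-- cyclotomic polynomials, defined by q^N - 1 = ∏_{d ∣ N} Φ_d(q)
cycTable : ℕ → List (ℕ × Poly)

prodDivisors : ℕ → List (ℕ × Poly) → Poly
prodDivisors N tbl = foldr (λ { (d , p) acc → if ⌊ d ∣? N ⌋ then p *P acc else acc }) oneP tbl

cyc : ℕ → Poly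
cyc zero    = oneP   -- Φ_0 is not used
cyc (suc n) = quotMonic (qPow (suc n) -P oneP) (prodDivisors (suc n) (cycTable n))

cycTable zero    = []
cycTable (suc n) = cycTable n ++ ((suc n , cyc (suc n)) ∷ [])

signPow : ℕ → ℤ
signPow zero    = 1ℤ
signPow (suc t) = ℤ.- signPow t

sumP : List Poly → Poly
sumP = foldr _+P_ []

theSum : (c : ℕ) → .{{_ : ℕ.NonZero c}} → (j l z : ℕ) → (P : Poly) → (n : ℕ) → Poly
theSum c j l z P n = sumP (map term (upTo (suc n)))
  where
  term : ℕ → Poly
  term m = if ⌊ (m ℕ.% c) ℕ.≟ j ⌋
           then scaleP (signPow ((m ℕ.∸ j) ℕ./ c) ℤ.* eval P (+ m))
                       (shiftP (z ℕ.* m) (derivN l (qbinom n m)))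
           else []

{-# OPTIONS --safe #-}
-- Let N = kc, let φ be the N-th cyclotomic polynomial and y = 1 + x^N. In ℤ[q][x] give φ weight 2 and
-- y weight 1, and let J a be the ideal spanned by the products of weight at least a. The Rogers–Szegő
-- polynomials H_n = Σ_m [n,m]_q x^m satisfy H_{n+2} = (1 + x) H_{n+1} - x (1 - q^{n+1}) H_n, and
-- H_N ≡ y mod φ because φ divides [N,m]_q for 0 < m < N. Modulo φ the recurrence is N-periodic, and a
-- defect of periodicity costs only a factor φ; hence H_n ∈ J a as soon as n ≥ a N.
-- The derivation d/dq lowers the weight by at most 2, x d/dx by at most 1, and x ↦ q^z x preserves it.
-- So Σ_m P(m) q^{zm} (d/dq)^l [n,m]_q x^m lies in J (2d + 1), i.e. has the form φ^{d+1} g + y h. The sum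
-- of the theorem is its image under x^{j+ct} ↦ (-1)^t (other powers ↦ 0), which kills y h as k is odd.
module Submission where

open import Defs
open import Algebra.Bundles using (CommutativeRing)
import Algebra.Properties.CommutativeSemiring.Exp
import Algebra.Properties.Semiring.Exp
open import Data.Bool using (if_then_else_; true; false)
open import Data.Integer as ℤ using (ℤ; +_; -[1+_]; 0ℤ; 1ℤ)
import Data.Integer.Properties as ℤP
open import Data.List using (List; []; _∷_; map; reverse; length; _++_; applyUpTo)
import Data.List.Properties as ListP
open import Data.Maybe using (Maybe; just; nothing)
open import Data.Nat as ℕ using (ℕ; zero; suc; z≤n; s≤s)
import Data.Nat.Divisibility as ℕD
import Data.Nat.DivMod as ℕM
open import Data.Nat.GCD using (gcd; gcd-GCD; gcd[m,n]∣m; gcd[m,n]∣n; module Bézout)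
import Data.Nat.Properties as ℕP
open import Data.Nat.Tactic.RingSolver using (solve-∀)
open import Data.Product using (_,_; ∃; ∃₂; _×_; proj₁; proj₂)
open import Data.Sum using (_⊎_; inj₁; inj₂)
open import Level using (0ℓ)
open import Relation.Binary using (tri<; tri≈; tri>)
open import Relation.Binary.PropositionalEquality as ≡ using (_≡_; _≢_)
open import Relation.Nullary using (¬_; yes; no; contradiction)
open import Relation.Nullary.Decidable using (⌊_⌋)

-- Polynomials over a commutative ring

-- The weight 2 of φ is forced by the recurrence. Going from index (a+1)N to (a+2)N leaves a term φ
-- v H_{(a+1)N-1}, and that neighbour is only known to lie in J a, so φ has to supply two units if
-- every period is to gain one. The bound on n is then a budget in units of N: deg P for the powers
-- of x d/dx, 2l for the derivatives in q, and 2d + 1 for what must remain. A generator of weight at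
-- least 2d + 1 either contains y or is a power of φ with at least d + 1 factors. The other obstacle
-- is Φ_N itself, given as the quotient of a long division whose remainder is discarded, so even the
-- exactness of that division needs proof. Everything rests on the separability of q^N - 1: factors
-- f, g with f g dividing it are coprime over ℚ, and divisibility by a monic polynomial descends
-- from ℚ to ℤ. A strong induction on N yields exactness, monicity, and the coprimality of Φ_N to
-- q^m - 1 when N does not divide m. With (1 - q^m)[N,m] = (1 - q^N)[N-1,m-1] the latter shows that
-- φ divides the inner coefficients of H_N.

module IntegerSolver (R : CommutativeRing 0ℓ 0ℓ) where
  open CommutativeRing R
  open import Algebra.Solver.Ring.AlmostCommutativeRing
  open import Algebra.Properties.Semiring.Mult.TCOptimised semiring renaming (_×_ to _·_)
  open import Algebra.Properties.Ring ring
  open import Algebra.Properties.AbelianGroup +-abelianGroup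
  open import Algebra.Properties.CommutativeSemigroup (CommutativeRing.+-commutativeSemigroup R) using (interchange)
  open import Relation.Binary.Reasoning.Setoid setoid

  -- The canonical map from ℤ. Through it the ring solver normalises with integer coefficients,
  -- whose equality is decidable, over a ring whose own equality need not be.
  ι : ℤ → Carrier
  ι (+ n)    = n · 1#
  ι -[1+ n ] = - (suc n · 1#)

  ι-⊖ : ∀ m n → ι (m ℤ.⊖ n) ≈ m · 1# - n · 1#
  ι-⊖ m zero = sym (trans (+-congˡ ε⁻¹≈ε) (+-identityʳ _))
  ι-⊖ zero (suc n) = sym (+-identityˡ _)
  ι-⊖ (suc m) (suc n) = begin
    ι (suc m ℤ.⊖ suc n)                 ≡⟨ ≡.cong ι (ℤP.[1+m]⊖[1+n]≡m⊖n m n) ⟩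
    ι (m ℤ.⊖ n)                         ≈⟨ ι-⊖ m n ⟩
    m · 1# - n · 1#                     ≈⟨ +-identityˡ _ ⟨
    0# + (m · 1# - n · 1#)              ≈⟨ +-congʳ (-‿inverseʳ 1#) ⟨
    (1# - 1#) + (m · 1# - n · 1#)       ≈⟨ interchange 1# (- 1#) _ _ ⟩
    (1# + m · 1#) + (- 1# - n · 1#)     ≈⟨ +-congˡ (⁻¹-∙-comm 1# _) ⟩
    (1# + m · 1#) - (1# + n · 1#)       ≈⟨ +-cong (1+× m 1#) (-‿cong (1+× n 1#)) ⟨
    suc m · 1# - suc n · 1#             ∎

  ι-neg : ∀ i → ι (ℤ.- i) ≈ - ι i
  ι-neg (+ zero)   = sym ε⁻¹≈ε
  ι-neg (+ suc n)  = refl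
  ι-neg -[1+ n ]   = sym (⁻¹-involutive _)

  ι-+ : ∀ i j → ι (i ℤ.+ j) ≈ ι i + ι j
  ι-+ (+ m)    (+ n)    = ×-homo-+ 1# m n
  ι-+ (+ m)    -[1+ n ] = ι-⊖ m (suc n)
  ι-+ -[1+ m ] (+ n)    = trans (ι-⊖ n (suc m)) (+-comm _ _)
  ι-+ -[1+ m ] -[1+ n ] = begin
    - (suc (suc (m ℕ.+ n)) · 1#)          ≡⟨ ≡.cong (λ k → - (suc k · 1#)) (≡.sym (ℕP.+-suc m n)) ⟩
    - ((suc m ℕ.+ suc n) · 1#)            ≈⟨ -‿cong (×-homo-+ 1# (suc m) (suc n)) ⟩
    - (suc m · 1# + suc n · 1#)           ≈⟨ ⁻¹-∙-comm _ _ ⟨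
    - (suc m · 1#) - suc n · 1#           ∎

  ι-*⁺ : ∀ m n → ι (+ m ℤ.* + n) ≈ ι (+ m) * ι (+ n)
  ι-*⁺ m n = trans (reflexive (≡.cong ι (≡.sym (ℤP.pos-* m n)))) (×1-homo-* m n)

  ι-* : ∀ i j → ι (i ℤ.* j) ≈ ι i * ι j
  ι-* (+ m)    (+ n)    = ι-*⁺ m n
  ι-* (+ m)    -[1+ n ] = begin
    ι (+ m ℤ.* -[1+ n ])          ≡⟨ ≡.cong ι (ℤP.neg-distribʳ-* (+ m) (+ suc n)) ⟨
    ι (ℤ.- (+ m ℤ.* + suc n))     ≈⟨ ι-neg (+ m ℤ.* + suc n) ⟩
    - ι (+ m ℤ.* + suc n)         ≈⟨ -‿cong (ι-*⁺ m (suc n)) ⟩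
    - (ι (+ m) * ι (+ suc n))     ≈⟨ -‿distribʳ-* _ _ ⟩
    ι (+ m) * - ι (+ suc n)       ∎
  ι-* -[1+ m ] j = begin
    ι (-[1+ m ] ℤ.* j)            ≡⟨ ≡.cong ι (ℤP.neg-distribˡ-* (+ suc m) j) ⟨
    ι (ℤ.- (+ suc m ℤ.* j))       ≈⟨ ι-neg (+ suc m ℤ.* j) ⟩
    - ι (+ suc m ℤ.* j)           ≈⟨ -‿cong (lem j) ⟩
    - (ι (+ suc m) * ι j)         ≈⟨ -‿distribˡ-* _ _ ⟩
    - ι (+ suc m) * ι j           ∎
    where
    lem : ∀ j → ι (+ suc m ℤ.* j) ≈ ι (+ suc m) * ι j
    lem (+ n) = ι-*⁺ (suc m) n
    lem -[1+ n ] = begin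
      ι (+ suc m ℤ.* -[1+ n ])          ≡⟨ ≡.cong ι (ℤP.neg-distribʳ-* (+ suc m) (+ suc n)) ⟨
      ι (ℤ.- (+ suc m ℤ.* + suc n))     ≈⟨ ι-neg (+ suc m ℤ.* + suc n) ⟩
      - ι (+ suc m ℤ.* + suc n)         ≈⟨ -‿cong (ι-*⁺ (suc m) (suc n)) ⟩
      - (ι (+ suc m) * ι (+ suc n))     ≈⟨ -‿distribʳ-* _ _ ⟩
      ι (+ suc m) * - ι (+ suc n)       ∎

  ι-morphism : CommutativeRing.rawRing ℤP.+-*-commutativeRing -Raw-AlmostCommutative⟶ fromCommutativeRing R
  ι-morphism = record
    { ⟦_⟧ = ι ; +-homo = ι-+ ; *-homo = ι-* ; -‿homo = ι-neg ; 0-homo = refl ; 1-homo = refl }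

  ι-≟ : ∀ i j → Maybe (ι i ≈ ι j)
  ι-≟ i j with i ℤ.≟ j
  ... | yes ≡.refl = just refl
  ... | no _       = nothing

  open import Algebra.Solver.Ring (CommutativeRing.rawRing ℤP.+-*-commutativeRing) (fromCommutativeRing R) ι-morphism ι-≟ public
    using (solve; _:=_; _:+_; _:*_; _:-_; :-_; con)

-- The ring of coefficient lists

module PolynomialRing (R : CommutativeRing 0ℓ 0ℓ) where
  open CommutativeRing R
  open IntegerSolver R
  open import Algebra.Properties.AbelianGroup +-abelianGroup using (ε⁻¹≈ε)
  open import Algebra.Properties.CommutativeSemigroup (CommutativeRing.+-commutativeSemigroup R) using (interchange)
  open import Relation.Binary.Reasoning.Setoid setoid

  infixl 6 _⊞_
  infixl 7 _⊠_
  infix 4 _≋_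

  coef : List Carrier → ℕ → Carrier
  coef []      _       = 0#
  coef (a ∷ f) zero    = a
  coef (a ∷ f) (suc i) = coef f i

  -- A record, unlike the bare function type, lets `f` and `g` be inferred from a proof of their
  -- equality.
  record _≋_ (f g : List Carrier) : Set where
    constructor coefwise
    field at : ∀ i → coef f i ≈ coef g i
  open _≋_ public

  scale : Carrier → List Carrier → List Carrier
  scale a = map (a *_)

  coef-scale : ∀ a f i → coef (scale a f) i ≈ a * coef f i
  coef-scale a []      i       = sym (zeroʳ a)
  coef-scale a (b ∷ f) zero    = refl
  coef-scale a (b ∷ f) (suc i) = coef-scale a f i

  conv : (ℕ → Carrier) → (ℕ → Carrier) → ℕ → Carrier
  conv F G zero    = F 0 * G 0
  conv F G (suc i) = F 0 * G (suc i) + conv (λ j → F (suc j)) G i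

  conv-cong : ∀ {F F′ G G′} → (∀ i → F i ≈ F′ i) → (∀ i → G i ≈ G′ i) → ∀ i → conv F G i ≈ conv F′ G′ i
  conv-cong p q zero    = *-cong (p 0) (q 0)
  conv-cong p q (suc i) = +-cong (*-cong (p 0) (q (suc i))) (conv-cong (λ j → p (suc j)) q i)

  conv-zeroˡ : ∀ G i → conv (λ _ → 0#) G i ≈ 0#
  conv-zeroˡ G zero    = zeroˡ _
  conv-zeroˡ G (suc i) = trans (+-cong (zeroˡ _) (conv-zeroˡ G i)) (+-identityˡ _)

  conv-+ : ∀ F G H i → conv (λ j → F j + G j) H i ≈ conv F H i + conv G H i
  conv-+ F G H zero    = distribʳ _ _ _
  conv-+ F G H (suc i) = trans (+-cong (distribʳ _ _ _) (conv-+ _ _ H i)) (interchange _ _ _ _)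

  conv-scale : ∀ a F G i → conv (λ j → a * F j) G i ≈ a * conv F G i
  conv-scale a F G zero    = *-assoc _ _ _
  conv-scale a F G (suc i) = trans (+-cong (*-assoc _ _ _) (conv-scale a _ G i)) (sym (distribˡ _ _ _))

  -- `conv` peels off the first entry of `F`; splitting off the first entry of `G` instead is what
  -- turns commutativity into an induction on the index.
  conv-suc : ∀ F G i → conv F G (suc i) ≈ F (suc i) * G 0 + conv F (λ j → G (suc j)) i
  conv-suc F G zero    = +-comm _ _
  conv-suc F G (suc i) = trans (+-congˡ (conv-suc _ G i))
    (solve 3 (λ a b c → a :+ (b :+ c) := b :+ (a :+ c)) refl _ _ _)

  conv-comm : ∀ F G i → conv F G i ≈ conv G F i
  conv-comm F G zero    = *-comm _ _
  conv-comm F G (suc i) = trans (+-cong (*-comm _ _) (conv-comm _ G i)) (sym (conv-suc G F i))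

  -- Opaque, so that unification and the ring solver treat the operations as those of an abstract ring.
  opaque
    _⊞_ : List Carrier → List Carrier → List Carrier
    []      ⊞ g       = g
    (a ∷ f) ⊞ []      = a ∷ f
    (a ∷ f) ⊞ (b ∷ g) = (a + b) ∷ (f ⊞ g)

    neg : List Carrier → List Carrier
    neg = map (-_)

    _⊠_ : List Carrier → List Carrier → List Carrier
    []      ⊠ g = []
    (a ∷ f) ⊠ g = scale a g ⊞ (0# ∷ (f ⊠ g))

    coef-⊞ : ∀ f g i → coef (f ⊞ g) i ≈ coef f i + coef g i
    coef-⊞ []      g       i       = sym (+-identityˡ _)
    coef-⊞ (a ∷ f) []      i       = sym (+-identityʳ _)
    coef-⊞ (a ∷ f) (b ∷ g) zero    = refl
    coef-⊞ (a ∷ f) (b ∷ g) (suc i) = coef-⊞ f g i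

    coef-neg : ∀ f i → coef (neg f) i ≈ - coef f i
    coef-neg []      i       = sym ε⁻¹≈ε
    coef-neg (b ∷ f) zero    = refl
    coef-neg (b ∷ f) (suc i) = coef-neg f i

    coef-⊠ : ∀ f g i → coef (f ⊠ g) i ≈ conv (coef f) (coef g) i
    coef-⊠ []      g i = sym (conv-zeroˡ _ i)
    coef-⊠ (a ∷ f) g zero = trans (coef-⊞ (scale a g) _ 0) (trans (+-identityʳ _) (coef-scale a g 0))
    coef-⊠ (a ∷ f) g (suc i) = trans (coef-⊞ (scale a g) _ (suc i)) (+-cong (coef-scale a g (suc i)) (coef-⊠ f g i))

    ∷-⊠ : ∀ a f g → (a ∷ f) ⊠ g ≡ scale a g ⊞ (0# ∷ (f ⊠ g))
    ∷-⊠ a f g = ≡.refl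

  ≋-refl : ∀ {f} → f ≋ f
  ≋-refl = coefwise λ i → refl

  ≋-sym : ∀ {f g} → f ≋ g → g ≋ f
  ≋-sym p = coefwise λ i → sym (at p i)

  ≋-trans : ∀ {f g h} → f ≋ g → g ≋ h → f ≋ h
  ≋-trans p q = coefwise λ i → trans (at p i) (at q i)

  ∷-cong : ∀ {a b f g} → a ≈ b → f ≋ g → (a ∷ f) ≋ (b ∷ g)
  ∷-cong p q = coefwise λ { zero → p ; (suc i) → at q i }

  ∷-tail : ∀ {a b f g} → (a ∷ f) ≋ (b ∷ g) → f ≋ g
  ∷-tail p = coefwise λ i → at p (suc i)

  ∷≋[] : ∀ {a f} → a ≈ 0# → f ≋ [] → (a ∷ f) ≋ []
  ∷≋[] p q = coefwise λ { zero → p ; (suc i) → at q i }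

  []-tail : ∀ {a f} → (a ∷ f) ≋ [] → f ≋ []
  []-tail p = coefwise λ i → at p (suc i)

  ⊞-cong : ∀ {f f′ g g′} → f ≋ f′ → g ≋ g′ → (f ⊞ g) ≋ (f′ ⊞ g′)
  ⊞-cong {f} {f′} {g} {g′} p q = coefwise λ i →
    trans (coef-⊞ f g i) (trans (+-cong (at p i) (at q i)) (sym (coef-⊞ f′ g′ i)))

  ⊞-assoc : ∀ f g h → ((f ⊞ g) ⊞ h) ≋ (f ⊞ (g ⊞ h))
  ⊞-assoc f g h = coefwise λ i → begin
    coef ((f ⊞ g) ⊞ h) i                ≈⟨ trans (coef-⊞ (f ⊞ g) h i) (+-congʳ (coef-⊞ f g i)) ⟩
    coef f i + coef g i + coef h i      ≈⟨ +-assoc _ _ _ ⟩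
    coef f i + (coef g i + coef h i)    ≈⟨ trans (coef-⊞ f (g ⊞ h) i) (+-congˡ (coef-⊞ g h i)) ⟨
    coef (f ⊞ (g ⊞ h)) i                ∎

  ⊞-comm : ∀ f g → (f ⊞ g) ≋ (g ⊞ f)
  ⊞-comm f g = coefwise λ i → trans (coef-⊞ f g i) (trans (+-comm _ _) (sym (coef-⊞ g f i)))

  ⊞-identityʳ : ∀ f → (f ⊞ []) ≋ f
  ⊞-identityʳ f = coefwise λ i → trans (coef-⊞ f [] i) (+-identityʳ _)

  ∷-⊞ : ∀ a b f g → ((a ∷ f) ⊞ (b ∷ g)) ≋ ((a + b) ∷ (f ⊞ g))
  ∷-⊞ a b f g = coefwise λ { zero → coef-⊞ (a ∷ f) (b ∷ g) 0
                           ; (suc i) → trans (coef-⊞ (a ∷ f) (b ∷ g) (suc i)) (sym (coef-⊞ f g i)) }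

  neg-cong : ∀ {f g} → f ≋ g → neg f ≋ neg g
  neg-cong {f} {g} p = coefwise λ i → trans (coef-neg f i) (trans (-‿cong (at p i)) (sym (coef-neg g i)))

  neg-inverseʳ : ∀ f → (f ⊞ neg f) ≋ []
  neg-inverseʳ f = coefwise λ i → trans (coef-⊞ f (neg f) i) (trans (+-congˡ (coef-neg f i)) (-‿inverseʳ _))

  ⊠-cong : ∀ {f f′ g g′} → f ≋ f′ → g ≋ g′ → (f ⊠ g) ≋ (f′ ⊠ g′)
  ⊠-cong {f} {f′} {g} {g′} p q = coefwise λ i →
    trans (coef-⊠ f g i) (trans (conv-cong (at p) (at q) i) (sym (coef-⊠ f′ g′ i)))

  ⊠-zeroˡ : ∀ f → ([] ⊠ f) ≋ []
  ⊠-zeroˡ f = coefwise λ i → trans (coef-⊠ [] f i) (conv-zeroˡ _ i)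

  ⊠-comm : ∀ f g → (f ⊠ g) ≋ (g ⊠ f)
  ⊠-comm f g = coefwise λ i → trans (coef-⊠ f g i) (trans (conv-comm _ _ i) (sym (coef-⊠ g f i)))

  ⊠-distribʳ : ∀ h f g → ((f ⊞ g) ⊠ h) ≋ ((f ⊠ h) ⊞ (g ⊠ h))
  ⊠-distribʳ h f g = coefwise λ i → begin
    coef ((f ⊞ g) ⊠ h) i                                      ≈⟨ coef-⊠ (f ⊞ g) h i ⟩
    conv (coef (f ⊞ g)) (coef h) i                            ≈⟨ conv-cong (coef-⊞ f g) (λ _ → refl) i ⟩
    conv (λ j → coef f j + coef g j) (coef h) i               ≈⟨ conv-+ _ _ _ i ⟩
    conv (coef f) (coef h) i + conv (coef g) (coef h) i       ≈⟨ +-cong (coef-⊠ f h i) (coef-⊠ g h i) ⟨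
    coef (f ⊠ h) i + coef (g ⊠ h) i                           ≈⟨ coef-⊞ (f ⊠ h) _ i ⟨
    coef ((f ⊠ h) ⊞ (g ⊠ h)) i                                ∎

  scale-⊠ : ∀ a f g → (scale a f ⊠ g) ≋ scale a (f ⊠ g)
  scale-⊠ a f g = coefwise λ i → begin
    coef (scale a f ⊠ g) i                     ≈⟨ coef-⊠ (scale a f) g i ⟩
    conv (coef (scale a f)) (coef g) i         ≈⟨ conv-cong (coef-scale a f) (λ _ → refl) i ⟩
    conv (λ j → a * coef f j) (coef g) i       ≈⟨ conv-scale a _ _ i ⟩
    a * conv (coef f) (coef g) i               ≈⟨ *-congˡ (coef-⊠ f g i) ⟨
    a * coef (f ⊠ g) i                         ≈⟨ coef-scale a (f ⊠ g) i ⟨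
    coef (scale a (f ⊠ g)) i                   ∎

  shift-⊠ : ∀ f g → ((0# ∷ f) ⊠ g) ≋ (0# ∷ (f ⊠ g))
  shift-⊠ f g = coefwise λ i → trans (reflexive (≡.cong (λ h → coef h i) (∷-⊠ 0# f g))) (trans (coef-⊞ (scale 0# g) _ i)
    (trans (+-congʳ (trans (coef-scale 0# g i) (zeroˡ _))) (+-identityˡ _)))

  ⊠-assoc : ∀ f g h → ((f ⊠ g) ⊠ h) ≋ (f ⊠ (g ⊠ h))
  ⊠-assoc [] g h = ≋-trans (⊠-cong (⊠-zeroˡ g) ≋-refl) (≋-trans (⊠-zeroˡ h) (≋-sym (⊠-zeroˡ (g ⊠ h))))
  ⊠-assoc (a ∷ f) g h rewrite ∷-⊠ a f g | ∷-⊠ a f (g ⊠ h) = ≋-trans (⊠-distribʳ h (scale a g) _)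
    (⊞-cong (scale-⊠ a g h) (≋-trans (shift-⊠ (f ⊠ g) h) (∷-cong refl (⊠-assoc f g h))))

  scale-one : ∀ f → scale 1# f ≋ f
  scale-one f = coefwise λ i → trans (coef-scale 1# f i) (*-identityˡ _)

  const-⊠ : ∀ a f → ((a ∷ []) ⊠ f) ≋ scale a f
  const-⊠ a f rewrite ∷-⊠ a [] f =
    ≋-trans (⊞-cong ≋-refl (∷≋[] refl (⊠-zeroˡ f))) (⊞-identityʳ (scale a f))

  ⊠-identityˡ : ∀ f → ((1# ∷ []) ⊠ f) ≋ f
  ⊠-identityˡ f = ≋-trans (const-⊠ 1# f) (scale-one f)

  polynomialRing : CommutativeRing 0ℓ 0ℓ
  polynomialRing = record
    { Carrier = List Carrier ; _≈_ = _≋_ ; _+_ = _⊞_ ; _*_ = _⊠_ ; -_ = neg ; 0# = [] ; 1# = 1# ∷ []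
    ; isCommutativeRing = record
      { isRing = record
        { +-isAbelianGroup = record
          { isGroup = record
            { isMonoid = record
              { isSemigroup = record
                { isMagma = record
                  { isEquivalence = record { refl = ≋-refl ; sym = ≋-sym ; trans = ≋-trans }
                  ; ∙-cong = ⊞-cong }
                ; assoc = ⊞-assoc }
              ; identity = (λ f → ≋-trans (⊞-comm [] f) (⊞-identityʳ f)) , ⊞-identityʳ }
            ; inverse = (λ f → ≋-trans (⊞-comm (neg f) f) (neg-inverseʳ f)) , neg-inverseʳ
            ; ⁻¹-cong = neg-cong }
          ; comm = ⊞-comm }
        ; *-cong = ⊠-cong
        ; *-assoc = ⊠-assoc
        ; *-identity = ⊠-identityˡ , λ f → ≋-trans (⊠-comm f _) (⊠-identityˡ f)
        ; distrib = (λ f g h → ≋-trans (⊠-comm f _) (≋-trans (⊠-distribʳ f g h) (⊞-cong (⊠-comm g f) (⊠-comm h f))))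
                  , ⊠-distribʳ }
      ; *-comm = ⊠-comm } }

record Derivation (R : CommutativeRing 0ℓ 0ℓ) : Set where
  open CommutativeRing R
  field
    δ       : Carrier → Carrier
    δ-cong  : ∀ {a b} → a ≈ b → δ a ≈ δ b
    δ-+     : ∀ a b → δ (a + b) ≈ δ a + δ b
    leibniz : ∀ a b → δ (a * b) ≈ δ a * b + a * δ b

  open import Algebra.Properties.Ring ring using (x+x≈x⇒x≈0)

  δ-0 : δ 0# ≈ 0#
  δ-0 = x+x≈x⇒x≈0 _ (trans (sym (δ-+ 0# 0#)) (δ-cong (+-identityˡ 0#)))

  δ-1 : δ 1# ≈ 0#
  δ-1 = x+x≈x⇒x≈0 _ (trans (+-cong (sym (*-identityʳ _)) (sym (*-identityˡ _)))
                        (trans (sym (leibniz 1# 1#)) (δ-cong (*-identityˡ 1#))))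

-- Its extensions to polynomials treat coefficients as constants: d/dq on ℤ[q] and x d/dx on ℤ[q][x]
-- both arise from it.
zeroDerivation : (R : CommutativeRing 0ℓ 0ℓ) → Derivation R
zeroDerivation R = record
  { δ = λ _ → 0# ; δ-cong = λ _ → refl ; δ-+ = λ _ _ → sym (+-identityˡ 0#)
  ; leibniz = λ a b → sym (trans (+-cong (zeroˡ b) (zeroʳ a)) (+-identityˡ 0#)) }
  where open CommutativeRing R

module PolynomialMaps (R : CommutativeRing 0ℓ 0ℓ) where
  private module A = CommutativeRing R
  open PolynomialRing R public
  open CommutativeRing polynomialRing
  open IntegerSolver polynomialRing
  open import Algebra.Properties.Semiring.Exp semiring using (_^_)
  private module Â = Algebra.Properties.Semiring.Exp A.semiring
  open import Algebra.Properties.AbelianGroup A.+-abelianGroup using (ε⁻¹≈ε)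
  open import Relation.Binary.Reasoning.Setoid setoid

  const : A.Carrier → Carrier
  const a = a ∷ []

  X : Carrier
  X = A.0# ∷ A.1# ∷ []

  const-cong : ∀ {a b} → a A.≈ b → const a ≈ const b
  const-cong p = ∷-cong p refl

  const-0 : const A.0# ≈ 0#
  const-0 = ∷≋[] A.refl refl

  const-+ : ∀ a b → const (a A.+ b) ≈ const a + const b
  const-+ a b = sym (trans (∷-⊞ a b [] []) (∷-cong A.refl (+-identityˡ _)))

  const-neg : ∀ a → const (A.- a) ≈ - const a
  const-neg a = coefwise λ { zero → A.sym (coef-neg (const a) 0)
                           ; (suc i) → A.sym (A.trans (coef-neg (const a) (suc i)) ε⁻¹≈ε) }

  const-* : ∀ a b → const (a A.* b) ≈ const a * const b
  const-* a b = sym (const-⊠ a (const b))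

  X-* : ∀ f → X * f ≈ A.0# ∷ f
  X-* f = trans (shift-⊠ _ f) (∷-cong A.refl (⊠-identityˡ f))

  ∷-split : ∀ a f → a ∷ f ≈ const a + X * f
  ∷-split a f = sym (trans (+-congˡ (X-* f)) (trans (∷-⊞ a A.0# [] f) (∷-cong (A.+-identityʳ a) (+-identityˡ f))))

  scale-const : ∀ a f → scale a f ≈ const a * f
  scale-const a f = sym (const-⊠ a f)

  ⊠-split : ∀ a f g → (a ∷ f) * g ≈ const a * g + X * (f * g)
  ⊠-split a f g = trans (reflexive (∷-⊠ a f g)) (+-cong (scale-const a g) (sym (X-* _)))

  coef-X^ : ∀ n → coef (X ^ n) n A.≈ A.1#
  coef-X^ zero    = A.refl
  coef-X^ (suc n) = A.trans (at (X-* (X ^ n)) (suc n)) (coef-X^ n)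

  coef-X^-≢ : ∀ n i → i ≢ n → coef (X ^ n) i A.≈ A.0#
  coef-X^-≢ zero    zero    i≢n = contradiction ≡.refl i≢n
  coef-X^-≢ zero    (suc i) i≢n = A.refl
  coef-X^-≢ (suc n) zero    i≢n = at (X-* (X ^ n)) 0
  coef-X^-≢ (suc n) (suc i) i≢n = A.trans (at (X-* (X ^ n)) (suc i)) (coef-X^-≢ n i λ i≡n → i≢n (≡.cong suc i≡n))

  const-^ : ∀ a n → const a ^ n ≈ const (a Â.^ n)
  const-^ a zero    = refl
  const-^ a (suc n) = trans (*-congˡ (const-^ a n)) (sym (const-* a (a Â.^ n)))

  coef-const* : ∀ a f i → coef (const a * f) i A.≈ a A.* coef f i
  coef-const* a f i = A.trans (at (const-⊠ a f) i) (coef-scale a f i)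

  coef-sub : ∀ f g i → coef (f - g) i A.≈ coef f i A.- coef g i
  coef-sub f g i = A.trans (coef-⊞ f (- g) i) (A.+-congˡ (coef-neg g i))

  coefs-divisible : ∀ a f → (∀ i → ∃ λ h → coef f i A.≈ a A.* h) → ∃ λ g → f ≈ const a * g
  coefs-divisible a []      p = [] , sym (zeroʳ (const a))
  coefs-divisible a (b ∷ f) p with p 0 | coefs-divisible a f (λ i → p (suc i))
  ... | h , eq | g , eq′ = h ∷ g , trans (∷-cong eq (trans eq′ (const-⊠ a g))) (sym (const-⊠ a (h ∷ g)))

  -- The derivation extending d from R to R[x] with x ↦ p.
  module ExtendDerivation (d : Derivation R) (p : Carrier) where
    open Derivation d

    D : Carrier → Carrier
    D []      = []
    D (a ∷ f) = const (δ a) + p * f + X * D f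

    -- `D` recurses on the representing list, so lists of zeros of any length have to be handled
    -- before lists of different lengths can be compared.
    D-zero : ∀ {f} → f ≈ 0# → D f ≈ 0#
    D-zero {[]} eq = refl
    D-zero {a ∷ f} eq = begin
      const (δ a) + p * f + X * D f
        ≈⟨ +-cong (+-cong (trans (const-cong (A.trans (δ-cong (at eq 0)) δ-0)) const-0) (*-congˡ ([]-tail eq)))
                  (*-congˡ (D-zero ([]-tail eq))) ⟩
      0# + p * 0# + X * 0#
        ≈⟨ solve 2 (λ p x → con 0ℤ :+ p :* con 0ℤ :+ x :* con 0ℤ := con 0ℤ) refl p X ⟩
      0# ∎

    D-cong : ∀ {f g} → f ≈ g → D f ≈ D g
    D-cong {[]}    {g}     eq = sym (D-zero (sym eq))
    D-cong {a ∷ f} {[]}    eq = D-zero eq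
    D-cong {a ∷ f} {b ∷ g} eq = +-cong
      (+-cong (const-cong (δ-cong (at eq 0))) (*-congˡ (∷-tail eq)))
      (*-congˡ (D-cong (∷-tail eq)))

    D-+ : ∀ f g → D (f + g) ≈ D f + D g
    D-+ []      g       = trans (D-cong (+-identityˡ g)) (sym (+-identityˡ _))
    D-+ (a ∷ f) []      = trans (D-cong (+-identityʳ (a ∷ f))) (sym (+-identityʳ _))
    D-+ (a ∷ f) (b ∷ g) = begin
      D ((a ∷ f) + (b ∷ g)) ≈⟨ D-cong (∷-⊞ a b f g) ⟩
      const (δ (a A.+ b)) + p * (f + g) + X * D (f + g)
        ≈⟨ +-cong (+-congʳ (trans (const-cong (δ-+ a b)) (const-+ (δ a) (δ b)))) (*-congˡ (D-+ f g)) ⟩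
      (const (δ a) + const (δ b)) + p * (f + g) + X * (D f + D g)
        ≈⟨ solve 8 (λ a b p f g x u v → (a :+ b) :+ p :* (f :+ g) :+ x :* (u :+ v)
             := (a :+ p :* f :+ x :* u) :+ (b :+ p :* g :+ x :* v)) refl _ _ p f g X _ _ ⟩
      D (a ∷ f) + D (b ∷ g) ∎

    D-const : ∀ a → D (const a) ≈ const (δ a)
    D-const a = solve 3 (λ a p x → a :+ p :* con 0ℤ :+ x :* con 0ℤ := a) refl _ p X

    D-X* : ∀ f → D (X * f) ≈ p * f + X * D f
    D-X* f = begin
      D (X * f)                             ≈⟨ D-cong (X-* f) ⟩
      const (δ A.0#) + p * f + X * D f      ≈⟨ +-congʳ (+-congʳ (trans (const-cong δ-0) const-0)) ⟩
      0# + p * f + X * D f                  ≈⟨ +-congʳ (+-identityˡ _) ⟩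
      p * f + X * D f                       ∎

    D-const* : ∀ a g → D (const a * g) ≈ const (δ a) * g + const a * D g
    D-const* a [] = trans (D-zero {const a * []} (zeroʳ (const a)))
      (sym (trans (+-cong (zeroʳ (const (δ a))) (zeroʳ (const a))) (+-identityˡ _)))
    D-const* a (b ∷ g) = begin
      D (const a * (b ∷ g))
        ≈⟨ D-cong (*-congˡ (∷-split b g)) ⟩
      D (const a * (const b + X * g))
        ≈⟨ D-cong (trans (solve 4 (λ a b x g → a :* (b :+ x :* g) := a :* b :+ x :* (a :* g)) refl (const a) (const b) X g)
             (+-congʳ (sym (const-* a b)))) ⟩
      D (const (a A.* b) + X * (const a * g))
        ≈⟨ trans (D-+ (const (a A.* b)) (X * (const a * g))) (+-cong (D-const _) (D-X* (const a * g))) ⟩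
      const (δ (a A.* b)) + (p * (const a * g) + X * D (const a * g))
        ≈⟨ +-cong (trans (const-cong (leibniz a b)) (trans (const-+ _ _) (+-cong (const-* (δ a) b) (const-* a (δ b))))) (+-congˡ (*-congˡ (D-const* a g))) ⟩
      (const (δ a) * const b + const a * const (δ b)) + (p * (const a * g) + X * (const (δ a) * g + const a * D g))
        ≈⟨ solve 8 (λ a′ a b′ b p g x g′ → (a′ :* b :+ a :* b′) :+ (p :* (a :* g) :+ x :* (a′ :* g :+ a :* g′))
             := a′ :* (b :+ x :* g) :+ a :* (b′ :+ p :* g :+ x :* g′)) refl
             (const (δ a)) (const a) (const (δ b)) (const b) p g X (D g) ⟩
      const (δ a) * (const b + X * g) + const a * D (b ∷ g)
        ≈⟨ +-congʳ (*-congˡ (sym (∷-split b g))) ⟩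
      const (δ a) * (b ∷ g) + const a * D (b ∷ g) ∎

    D-leibniz : ∀ f g → D (f * g) ≈ D f * g + f * D g
    D-leibniz []      g = trans (D-zero (zeroˡ g)) (sym (trans (+-cong (zeroˡ g) (zeroˡ (D g))) (+-identityˡ _)))
    D-leibniz (a ∷ f) g = begin
      D ((a ∷ f) * g)
        ≈⟨ D-cong (⊠-split a f g) ⟩
      D (const a * g + X * (f * g))
        ≈⟨ trans (D-+ (const a * g) (X * (f * g))) (+-cong (D-const* a g) (D-X* (f * g))) ⟩
      (const (δ a) * g + const a * D g) + (p * (f * g) + X * D (f * g))
        ≈⟨ +-congˡ (+-congˡ (*-congˡ (D-leibniz f g))) ⟩
      (const (δ a) * g + const a * D g) + (p * (f * g) + X * (D f * g + f * D g))
        ≈⟨ solve 8 (λ a′ a g g′ p f x f′ → (a′ :* g :+ a :* g′) :+ (p :* (f :* g) :+ x :* (f′ :* g :+ f :* g′))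
             := (a′ :+ p :* f :+ x :* f′) :* g :+ (a :* g′ :+ x :* (f :* g′))) refl
             (const (δ a)) (const a) g (D g) p f X (D f) ⟩
      D (a ∷ f) * g + (const a * D g + X * (f * D g))
        ≈⟨ +-congˡ (sym (⊠-split a f (D g))) ⟩
      D (a ∷ f) * g + (a ∷ f) * D g ∎

    derivation : Derivation polynomialRing
    derivation = record { δ = D ; δ-cong = D-cong ; δ-+ = D-+ ; leibniz = D-leibniz }

  module Substitution (p : Carrier) where

    -- Horner's rule at `p`: the endomorphism over `R` that sends the variable to `p`.
    σ : Carrier → Carrier
    σ []      = []
    σ (a ∷ f) = const a + p * σ f

    σ-zero : ∀ {f} → f ≈ 0# → σ f ≈ 0#
    σ-zero {[]}    eq = refl
    σ-zero {a ∷ f} eq = trans (+-cong (trans (const-cong (at eq 0)) const-0) (*-congˡ (σ-zero ([]-tail eq))))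
      (trans (+-identityˡ _) (zeroʳ p))

    σ-cong : ∀ {f g} → f ≈ g → σ f ≈ σ g
    σ-cong {[]}    {g}     eq = sym (σ-zero (sym eq))
    σ-cong {a ∷ f} {[]}    eq = σ-zero eq
    σ-cong {a ∷ f} {b ∷ g} eq = +-cong (const-cong (at eq 0)) (*-congˡ (σ-cong (∷-tail eq)))

    σ-+ : ∀ f g → σ (f + g) ≈ σ f + σ g
    σ-+ []      g       = trans (σ-cong (+-identityˡ g)) (sym (+-identityˡ _))
    σ-+ (a ∷ f) []      = trans (σ-cong (+-identityʳ (a ∷ f))) (sym (+-identityʳ _))
    σ-+ (a ∷ f) (b ∷ g) = trans (trans (σ-cong (∷-⊞ a b f g)) (+-cong (const-+ a b) (*-congˡ (σ-+ f g))))
      (solve 5 (λ a b p f g → (a :+ b) :+ p :* (f :+ g) := (a :+ p :* f) :+ (b :+ p :* g)) refl (const a) (const b) p _ _)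

    σ-const : ∀ a → σ (const a) ≈ const a
    σ-const a = trans (+-congˡ (zeroʳ p)) (+-identityʳ _)

    σ-X* : ∀ f → σ (X * f) ≈ p * σ f
    σ-X* f = trans (σ-cong (X-* f)) (trans (+-congʳ const-0) (+-identityˡ _))

    σ-const* : ∀ a g → σ (const a * g) ≈ const a * σ g
    σ-const* a [] = trans (σ-zero {const a * []} (zeroʳ (const a))) (sym (zeroʳ (const a)))
    σ-const* a (b ∷ g) = begin
      σ (const a * (b ∷ g))
        ≈⟨ σ-cong (trans (*-congˡ (∷-split b g))
             (trans (solve 4 (λ a b x g → a :* (b :+ x :* g) := a :* b :+ x :* (a :* g)) refl (const a) (const b) X g)
                    (+-congʳ (sym (const-* a b))))) ⟩
      σ (const (a A.* b) + X * (const a * g))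
        ≈⟨ trans (σ-+ (const (a A.* b)) (X * (const a * g))) (+-cong (σ-const _) (σ-X* (const a * g))) ⟩
      const (a A.* b) + p * σ (const a * g)
        ≈⟨ +-cong (const-* a b) (*-congˡ (σ-const* a g)) ⟩
      const a * const b + p * (const a * σ g)
        ≈⟨ solve 4 (λ a b p g → a :* b :+ p :* (a :* g) := a :* (b :+ p :* g)) refl (const a) (const b) p (σ g) ⟩
      const a * σ (b ∷ g) ∎

    σ-* : ∀ f g → σ (f * g) ≈ σ f * σ g
    σ-* []      g = trans (σ-zero (zeroˡ g)) (sym (zeroˡ _))
    σ-* (a ∷ f) g = begin
      σ ((a ∷ f) * g)
        ≈⟨ σ-cong (⊠-split a f g) ⟩
      σ (const a * g + X * (f * g))
        ≈⟨ trans (σ-+ (const a * g) (X * (f * g))) (+-cong (σ-const* a g) (σ-X* (f * g))) ⟩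
      const a * σ g + p * σ (f * g)
        ≈⟨ +-congˡ (*-congˡ (σ-* f g)) ⟩
      const a * σ g + p * (σ f * σ g)
        ≈⟨ solve 4 (λ a g p f → a :* g :+ p :* (f :* g) := (a :+ p :* f) :* g) refl (const a) (σ g) p (σ f) ⟩
      σ (a ∷ f) * σ g ∎

-- The filtration and the recurrence

module Filtration (B : CommutativeRing 0ℓ 0ℓ) (φ y : CommutativeRing.Carrier B) where
  open CommutativeRing B
  open IntegerSolver B
  open import Algebra.Properties.Semiring.Exp semiring using (_^_)
  open import Relation.Binary.Reasoning.Setoid setoid

  -- The ideals J a generated by the products φ^i y^j with 2i + j ≥ a.
  data J : ℕ → Carrier → Set where
    J-all  : ∀ {f} → J 0 f
    J-resp : ∀ {a f g} → f ≈ g → J a f → J a g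
    J-+    : ∀ {a f g} → J a f → J a g → J a (f + g)
    J-*    : ∀ {a f} r → J a f → J a (r * f)
    J-weak : ∀ {a f} → J (suc a) f → J a f
    J-φ    : ∀ {a f} → J a f → J (suc (suc a)) (φ * f)
    J-y    : ∀ {a f} → J a f → J (suc a) (y * f)

  J-mul : ∀ {a b f g} → J a f → J b g → J (a ℕ.+ b) (f * g)
  J-mul {f = f} J-all q = J-* f q
  J-mul (J-resp e p) q = J-resp (*-congʳ e) (J-mul p q)
  J-mul (J-+ p p′)   q = J-resp (sym (distribʳ _ _ _)) (J-+ (J-mul p q) (J-mul p′ q))
  J-mul (J-* r p)    q = J-resp (sym (*-assoc _ _ _)) (J-* r (J-mul p q))
  J-mul (J-weak p)   q = J-weak (J-mul p q)
  J-mul (J-φ p)      q = J-resp (sym (*-assoc _ _ _)) (J-φ (J-mul p q))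
  J-mul (J-y p)      q = J-resp (sym (*-assoc _ _ _)) (J-y (J-mul p q))

  J-weaken : ∀ n {a f} → J (n ℕ.+ a) f → J a f
  J-weaken zero    p = p
  J-weaken (suc n) p = J-weaken n (J-weak p)

  J-φ₁ : ∀ {f} → J 1 (φ * f)
  J-φ₁ = J-weak (J-φ J-all)

  module _ (d : Derivation B) where
    open Derivation d

    -- By the Leibniz rule each summand loses at most one generator, and the heavier generator
    -- weighs 2.
    J-δ₂ : ∀ {a f} → J (suc (suc a)) f → J a (δ f)
    J-δ₂ {zero} _ = J-all
    J-δ₂ {suc a} (J-resp e p) = J-resp (δ-cong e) (J-δ₂ p)
    J-δ₂ {suc a} (J-+ p q)    = J-resp (sym (δ-+ _ _)) (J-+ (J-δ₂ p) (J-δ₂ q))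
    J-δ₂ {suc a} (J-* r p)    = J-resp (sym (leibniz _ _)) (J-+ (J-* (δ r) (J-weak (J-weak p))) (J-* r (J-δ₂ p)))
    J-δ₂ {suc a} (J-weak p)   = J-weak (J-δ₂ p)
    -- Weight 1 of `f` is too little for the induction hypothesis, but in `φ * δ f` the surviving
    -- `φ` alone suffices for weight 1.
    J-δ₂ {suc zero} (J-φ p)   = J-resp (sym (leibniz _ _)) (J-+ (J-* (δ φ) p) J-φ₁)
    J-δ₂ {suc (suc a)} (J-φ p) = J-resp (sym (leibniz _ _)) (J-+ (J-* (δ φ) p) (J-φ (J-δ₂ p)))
    J-δ₂ {suc a} (J-y p)      = J-resp (sym (leibniz _ _)) (J-+ (J-* (δ y) (J-weak p)) (J-y (J-δ₂ p)))

    -- When `φ` is a constant for `δ`, only a factor `y` can be destroyed, which costs one unit.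
    -- This is the situation of x d/dx, for which all of ℤ[q] is constant.
    J-δ₁ : δ φ ≈ 0# → ∀ {a f} → J (suc a) f → J a (δ f)
    J-δ₁ δφ {zero} _ = J-all
    J-δ₁ δφ {suc a} (J-resp e p) = J-resp (δ-cong e) (J-δ₁ δφ p)
    J-δ₁ δφ {suc a} (J-+ p q)    = J-resp (sym (δ-+ _ _)) (J-+ (J-δ₁ δφ p) (J-δ₁ δφ q))
    J-δ₁ δφ {suc a} (J-* r p)    = J-resp (sym (leibniz _ _)) (J-+ (J-* (δ r) (J-weak p)) (J-* r (J-δ₁ δφ p)))
    J-δ₁ δφ {suc a} (J-weak p)   = J-weak (J-δ₁ δφ p)
    J-δ₁ δφ {suc a} (J-φ {f = f} p) = J-resp
      (sym (trans (leibniz _ _) (trans (+-congʳ (trans (*-congʳ δφ) (zeroˡ f))) (+-identityˡ _)))) (lem p)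
      where
      lem : ∀ {a f} → J a f → J (suc a) (φ * δ f)
      lem {zero}  p = J-φ₁
      lem {suc a} p = J-φ (J-δ₁ δφ p)
    J-δ₁ δφ {suc a} (J-y p)      = J-resp (sym (leibniz _ _)) (J-+ (J-* (δ y) p) (J-y (J-δ₁ δφ p)))

  -- Asking only for `σ y` of weight 1 matters: the substitution x ↦ q^z x sends `y` to `y` plus a
  -- multiple of `φ`.
  J-hom : (σ : Carrier → Carrier) → (∀ {f g} → f ≈ g → σ f ≈ σ g) →
    (∀ f g → σ (f + g) ≈ σ f + σ g) → (∀ f g → σ (f * g) ≈ σ f * σ g) →
    σ φ ≈ φ → J 1 (σ y) → ∀ {a f} → J a f → J a (σ f)
  J-hom σ σ-cong σ-+ σ-* σφ σy = go
    where
    go : ∀ {a f} → J a f → J a (σ f)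
    go J-all        = J-all
    go (J-resp e p) = J-resp (σ-cong e) (go p)
    go (J-+ p q)    = J-resp (sym (σ-+ _ _)) (J-+ (go p) (go q))
    go (J-* r p)    = J-resp (sym (σ-* _ _)) (J-* (σ r) (go p))
    go (J-weak p)   = J-weak (go p)
    go (J-φ p)      = J-resp (sym (trans (σ-* _ _) (*-congʳ σφ))) (J-φ (go p))
    go (J-y p)      = J-resp (sym (σ-* _ _)) (J-mul σy (go p))

  -- Modulo `y` only powers φ^i with 2i ≥ a survive, and 2e ≤ a + 1 then forces i ≥ e by parity.
  J-decompose : ∀ {a f} → J a f → ∀ e → 2 ℕ.* e ℕ.≤ suc a → ∃₂ λ g h → f ≈ φ ^ e * g + y * h
  J-decompose {f = f} p zero _ = f , 0# , solve 2 (λ f y → f := con 1ℤ :* f :+ y :* con 0ℤ) refl f y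
  J-decompose J-all (suc e) (s≤s le) with ℕP.m+n≤o⇒n≤o e le
  ... | ()
  J-decompose (J-resp eq p) (suc e) le with J-decompose p (suc e) le
  ... | g , h , q = g , h , trans (sym eq) q
  J-decompose (J-+ p p′) (suc e) le with J-decompose p (suc e) le | J-decompose p′ (suc e) le
  ... | g , h , q | g′ , h′ , q′ = g + g′ , h + h′ , trans (+-cong q q′)
    (solve 6 (λ f y g h g′ h′ → (f :* g :+ y :* h) :+ (f :* g′ :+ y :* h′) := f :* (g :+ g′) :+ y :* (h :+ h′)) refl
      (φ ^ suc e) y g h g′ h′)
  J-decompose (J-* r p) (suc e) le with J-decompose p (suc e) le
  ... | g , h , q = r * g , r * h , trans (*-congˡ q)
    (solve 5 (λ f y g h r → r :* (f :* g :+ y :* h) := f :* (r :* g) :+ y :* (r :* h)) refl (φ ^ suc e) y g h r)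
  J-decompose (J-weak p) (suc e) le = J-decompose p (suc e) (ℕP.m≤n⇒m≤1+n le)
  J-decompose (J-φ {a} p) (suc e) le with J-decompose p e (ℕP.≤-pred (ℕP.≤-pred (≡.subst (ℕ._≤ suc (suc (suc a))) (ℕP.*-suc 2 e) le)))
  ... | g , h , q = g , φ * h , trans (*-congˡ q)
    (solve 5 (λ f k y g h → f :* (k :* g :+ y :* h) := (f :* k) :* g :+ y :* (f :* h)) refl φ (φ ^ e) y g h)
  J-decompose (J-y {f = f} p) (suc e) le = 0# , f , solve 3 (λ k y f → y :* f := k :* con 0ℤ :+ y :* f) refl (φ ^ suc e) y f

-- The three-term recurrence and the weight of its solution

module Recurrence (B : CommutativeRing 0ℓ 0ℓ) (x q φ : CommutativeRing.Carrier B) where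
  open CommutativeRing B
  open IntegerSolver B
  open import Algebra.Properties.Semiring.Exp semiring using (_^_; ^-homo-*)
  open import Relation.Binary.Reasoning.Setoid setoid

  H : ℕ → Carrier
  H zero          = 1#
  H (suc zero)    = 1# + x
  H (suc (suc n)) = (1# + x) * H (suc n) - x * (1# - q ^ suc n) * H n

  -- Since q^(s+1) is 1 modulo `φ`, the sequences i ↦ H (s+1+i) and i ↦ H i * H (s+1) obey the same
  -- recurrence modulo `φ` and agree there at i = 0 and i = 1. The errors are tracked as
  -- combinations of `H (suc s)` and `H s`, because a bare multiple of `φ` would forget the weight
  -- these already have.
  H-step : ∀ s ψ → 1# - q ^ suc s ≈ φ * ψ → ∀ i →
    ∃₂ λ u v → H (suc s ℕ.+ i) ≈ (H i + φ * u) * H (suc s) + φ * v * H s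
  H-step s ψ eq i = proj₁ (go i)
    where
    P : ℕ → Set
    P i = ∃₂ λ u v → H (suc s ℕ.+ i) ≈ (H i + φ * u) * H (suc s) + φ * v * H s

    pow : ∀ i → 1# - q ^ (suc s ℕ.+ suc i) ≈ (1# - q ^ suc i) + φ * (ψ * q ^ suc i)
    pow i = begin
      1# - q ^ (suc s ℕ.+ suc i)                             ≈⟨ +-congˡ (-‿cong (^-homo-* q (suc s) (suc i))) ⟩
      1# - q ^ suc s * q ^ suc i                             ≈⟨ solve 2 (λ a b → con 1ℤ :- a :* b := (con 1ℤ :- b) :+ (con 1ℤ :- a) :* b) refl (q ^ suc s) (q ^ suc i) ⟩
      (1# - q ^ suc i) + (1# - q ^ suc s) * q ^ suc i        ≈⟨ +-congˡ (trans (*-congʳ eq) (*-assoc _ _ _)) ⟩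
      (1# - q ^ suc i) + φ * (ψ * q ^ suc i)                 ∎

    go : ∀ i → P i × P (suc i)
    go zero = (0# , 0# , trans (reflexive (≡.cong H (ℕP.+-identityʳ (suc s))))
                 (solve 3 (λ h g f → h := (con 1ℤ :+ f :* con 0ℤ) :* h :+ f :* con 0ℤ :* g) refl (H (suc s)) (H s) φ))
            -- At i = 1 the recurrence contributes x (1 - q^(s+1)) H s, which is x φ ψ H s; this is
            -- the first defect.
            , (0# , - (x * ψ) , (begin
                 H (suc s ℕ.+ 1)
                   ≡⟨ ≡.cong H (ℕP.+-comm (suc s) 1) ⟩
                 (1# + x) * H (suc s) - x * (1# - q ^ suc s) * H s
                   ≈⟨ +-congˡ (-‿cong (*-congʳ (*-congˡ eq))) ⟩
                 (1# + x) * H (suc s) - x * (φ * ψ) * H s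
                   ≈⟨ solve 5 (λ x h f p g → (con 1ℤ :+ x) :* h :- x :* (f :* p) :* g
                        := ((con 1ℤ :+ x) :+ f :* con 0ℤ) :* h :+ f :* (:- (x :* p)) :* g) refl x (H (suc s)) φ ψ (H s) ⟩
                 (1# + x + φ * 0#) * H (suc s) + φ * - (x * ψ) * H s ∎))
    go (suc i) with go i
    ... | p@(u , v , e) , p′@(u′ , v′ , e′) = p′ ,
      -- The new witnesses are read off by inserting the two previous identities into the recurrence
      -- and collecting multiples of `H (suc s)` and `H s`; the terms with `ψ * q ^ suc i` come from
      -- the defect in `pow`.
      ( (1# + x) * u′ - x * (1# - q ^ suc i) * u - x * (ψ * q ^ suc i) * (H i + φ * u)
      , (1# + x) * v′ - x * ((1# - q ^ suc i) + φ * (ψ * q ^ suc i)) * v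
      , (begin
        H (suc s ℕ.+ suc (suc i))
          ≡⟨ ≡.cong H (≡.trans (ℕP.+-suc (suc s) (suc i)) (≡.cong suc (ℕP.+-suc (suc s) i))) ⟩
        (1# + x) * H (suc (suc s ℕ.+ i)) - x * (1# - q ^ suc (suc s ℕ.+ i)) * H (suc s ℕ.+ i)
          ≡⟨ ≡.cong (λ k → (1# + x) * H k - x * (1# - q ^ k) * H (suc s ℕ.+ i)) (≡.sym (ℕP.+-suc (suc s) i)) ⟩
        (1# + x) * H (suc s ℕ.+ suc i) - x * (1# - q ^ (suc s ℕ.+ suc i)) * H (suc s ℕ.+ i)
          ≈⟨ +-cong (*-congˡ e′) (-‿cong (*-cong (*-congˡ (pow i)) e)) ⟩
        (1# + x) * ((H (suc i) + φ * u′) * H (suc s) + φ * v′ * H s)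
          - x * ((1# - q ^ suc i) + φ * (ψ * q ^ suc i)) * ((H i + φ * u) * H (suc s) + φ * v * H s)
          ≈⟨ solve 12 (λ x f k h′ h u v u′ v′ hs g p →
               (con 1ℤ :+ x) :* ((h′ :+ f :* u′) :* hs :+ f :* v′ :* g)
                 :- x :* (k :+ f :* p) :* ((h :+ f :* u) :* hs :+ f :* v :* g)
               := ((con 1ℤ :+ x) :* h′ :- x :* k :* h
                    :+ f :* ((con 1ℤ :+ x) :* u′ :- x :* k :* u :- x :* p :* (h :+ f :* u))) :* hs
                 :+ f :* ((con 1ℤ :+ x) :* v′ :- x :* (k :+ f :* p) :* v) :* g) refl
               x φ (1# - q ^ suc i) (H (suc i)) (H i) u v u′ v′ (H (suc s)) (H s) (ψ * q ^ suc i) ⟩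
        (H (suc (suc i)) + φ * ((1# + x) * u′ - x * (1# - q ^ suc i) * u - x * (ψ * q ^ suc i) * (H i + φ * u))) * H (suc s)
          + φ * ((1# + x) * v′ - x * ((1# - q ^ suc i) + φ * (ψ * q ^ suc i)) * v) * H s ∎))

  module _ (y : Carrier) (N : ℕ) (ψ w : Carrier)
    (qᴺ : 1# - q ^ suc N ≈ φ * ψ) (Hᴺ : H (suc N) ≈ y + φ * w) where
    open Filtration B φ y

    1-qᵃᴺ : ∀ a → ∃ λ χ → 1# - q ^ (a ℕ.* suc N) ≈ φ * χ
    1-qᵃᴺ zero    = 0# , solve 1 (λ f → con 1ℤ :- con 1ℤ := f :* con 0ℤ) refl φ
    1-qᵃᴺ (suc a) with 1-qᵃᴺ a
    ... | χ , eq = ψ + q ^ suc N * χ , (begin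
      1# - q ^ (suc N ℕ.+ a ℕ.* suc N)
        ≈⟨ +-congˡ (-‿cong (^-homo-* q (suc N) (a ℕ.* suc N))) ⟩
      1# - q ^ suc N * q ^ (a ℕ.* suc N)
        ≈⟨ solve 2 (λ a b → con 1ℤ :- a :* b := (con 1ℤ :- a) :+ a :* (con 1ℤ :- b)) refl _ _ ⟩
      (1# - q ^ suc N) + q ^ suc N * (1# - q ^ (a ℕ.* suc N))
        ≈⟨ +-cong qᴺ (*-congˡ eq) ⟩
      φ * ψ + q ^ suc N * (φ * χ)
        ≈⟨ solve 4 (λ f p k c → f :* p :+ k :* (f :* c) := f :* (p :+ k :* c)) refl φ ψ (q ^ suc N) χ ⟩
      φ * (ψ + q ^ suc N * χ) ∎)

    H∈J₁ : J 1 (H (suc N))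
    H∈J₁ = J-resp (trans (+-congʳ (*-identityʳ y)) (sym Hᴺ)) (J-+ (J-y {f = 1#} J-all) J-φ₁)

    -- Weight, once reached at `suc s`, persists at all later indices: the defect `φ * v * H s` has
    -- weight a + 2, one more than required.
    H∈J-+ : ∀ a s i → (∃ λ χ → 1# - q ^ suc s ≈ φ * χ) →
      J (suc a) (H (suc s)) → J a (H s) → J (suc a) (H (suc s ℕ.+ i))
    H∈J-+ a s i (χ , eq) p p′ with H-step s χ eq i
    ... | u , v , e = J-resp (sym e) (J-+ (J-* _ p) (J-resp (sym (*-assoc _ _ _)) (J-weak (J-φ (J-* v p′)))))

    -- A full period gains one unit: `H (suc N)` contributes weight 1 to the main term, and in
    -- `φ * v * H s` the weight 2 of `φ` exactly bridges the gap between a and a + 2.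
    H∈J-+N : ∀ a s → (∃ λ χ → 1# - q ^ suc s ≈ φ * χ) →
      J (suc a) (H (suc s)) → J a (H s) → J (suc (suc a)) (H (suc s ℕ.+ suc N))
    H∈J-+N a s (χ , eq) p p′ with H-step s χ eq (suc N)
    ... | u , v , e = J-resp (sym e)
      (J-+ (J-resp (sym (distribʳ _ _ _))
             (J-+ (J-mul H∈J₁ p) (J-resp (sym (*-assoc _ _ _)) (J-φ (J-* u (J-weak p))))))
           (J-resp (sym (*-assoc _ _ _)) (J-φ (J-* v p′))))

    -- The gain at a multiple of the period involves the index just before the previous multiple,
    -- which carries one unit less; hence exact multiples and arbitrary later indices are treated by
    -- mutual induction.
    H∈J : ∀ a i → J a (H (a ℕ.* suc N ℕ.+ i))
    H∈J-at : ∀ a → J (suc a) (H (suc a ℕ.* suc N))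

    H∈J zero    i = J-all
    H∈J (suc a) i = H∈J-+ a (N ℕ.+ a ℕ.* suc N) i (1-qᵃᴺ (suc a)) (H∈J-at a)
      -- The predecessor of (a+1)(N+1) is a(N+1) + N, so it has weight a.
      (≡.subst (λ k → J a (H k)) (ℕP.+-comm (a ℕ.* suc N) N) (H∈J a N))

    H∈J-at zero    = ≡.subst (λ k → J 1 (H k)) (≡.sym (ℕP.+-identityʳ (suc N))) H∈J₁
    H∈J-at (suc a) = ≡.subst (λ k → J (suc (suc a)) (H k)) (ℕP.+-comm (suc a ℕ.* suc N) (suc N))
      (H∈J-+N a (N ℕ.+ a ℕ.* suc N) (1-qᵃᴺ (suc a)) (H∈J-at a)
        (≡.subst (λ k → J a (H k)) (ℕP.+-comm (a ℕ.* suc N) N) (H∈J a N)))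

-- q-binomial coefficients

module Q = PolynomialMaps ℤP.+-*-commutativeRing

ℤ[q] : CommutativeRing 0ℓ 0ℓ
ℤ[q] = Q.polynomialRing

module W = PolynomialMaps ℤ[q]

ℤ[q][x] : CommutativeRing 0ℓ 0ℓ
ℤ[q][x] = W.polynomialRing

module A = CommutativeRing ℤ[q]
module Â = Algebra.Properties.Semiring.Exp A.semiring
module B = CommutativeRing ℤ[q][x]
module B̂ = Algebra.Properties.Semiring.Exp B.semiring

open Q using (_≋_; coefwise; at)

coeff≡ : ∀ f i → coeff f i ≡ Q.coef f i
coeff≡ []      i       = ≡.refl
coeff≡ (a ∷ f) zero    = ≡.refl
coeff≡ (a ∷ f) (suc i) = coeff≡ f i

≋⇒≈P : ∀ {f g} → f ≋ g → f ≈P g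
≋⇒≈P {f} {g} p i = ≡.trans (coeff≡ f i) (≡.trans (at p i) (≡.sym (coeff≡ g i)))

opaque
  unfolding Q._⊞_

  +P≡ : ∀ f g → f +P g ≡ f Q.⊞ g
  +P≡ []      g       = ≡.refl
  +P≡ (a ∷ f) []      = ≡.refl
  +P≡ (a ∷ f) (b ∷ g) = ≡.cong (a ℤ.+ b ∷_) (+P≡ f g)

  negP≡ : ∀ f → negP f ≡ Q.neg f
  negP≡ f = ≡.refl

  *P≡ : ∀ f g → f *P g ≡ f Q.⊠ g
  *P≡ []      g = ≡.refl
  *P≡ (a ∷ f) g = ≡.trans (+P≡ (scaleP a g) _) (≡.cong (λ h → scaleP a g Q.⊞ (0ℤ ∷ h)) (*P≡ f g))

module QBinomial where
  open CommutativeRing ℤ[q]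
  open IntegerSolver ℤ[q]
  open Algebra.Properties.Semiring.Exp semiring using (_^_)
  open import Relation.Binary.Reasoning.Setoid setoid

  q : Poly
  q = Q.X

  ^P≡ : ∀ f n → f ^P n ≡ f ^ n
  ^P≡ f zero    = ≡.refl
  ^P≡ f (suc n) = ≡.trans (*P≡ f _) (≡.cong (f *_) (^P≡ f n))

  shiftP≈ : ∀ n f → shiftP n f ≈ q ^ n * f
  shiftP≈ zero    f = sym (*-identityˡ f)
  shiftP≈ (suc n) f = trans (Q.∷-cong ≡.refl (shiftP≈ n f)) (trans (sym (Q.X-* (q ^ n * f))) (sym (*-assoc q (q ^ n) f)))

  pascal : ∀ n m → qbinom (suc n) (suc m) ≈ qbinom n m + q ^ suc m * qbinom n (suc m)
  pascal n m = trans (reflexive (+P≡ (qbinom n m) _)) (+-congˡ (shiftP≈ (suc m) (qbinom n (suc m))))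

  mutual
    -- Immediate for the quotient of q-factorials; from the Pascal rule alone it needs a
    -- simultaneous induction with a relation between neighbours in one row.
    absorb : ∀ n m → (1# - q ^ suc m) * qbinom (suc n) (suc m) ≈ (1# - q ^ suc n) * qbinom n m
    absorb zero zero = trans (*-congˡ (pascal 0 0))
      (solve 2 (λ q a → (con 1ℤ :- a) :* (con 1ℤ :+ a :* con 0ℤ) := (con 1ℤ :- a) :* con 1ℤ) refl q (q ^ 1))
    absorb zero (suc m) = trans (*-congˡ (pascal 0 (suc m)))
      (solve 2 (λ a b → (con 1ℤ :- a) :* (con 0ℤ :+ a :* con 0ℤ) := (con 1ℤ :- b) :* con 0ℤ) refl (q ^ suc (suc m)) (q ^ 1))
    absorb (suc n) m = begin
      (1# - q ^ suc m) * qbinom (suc (suc n)) (suc m)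
        ≈⟨ *-congˡ (pascal (suc n) m) ⟩
      (1# - q * q ^ m) * (β + q * q ^ m * γ)
        ≈⟨ solve 4 (λ q a b g → (con 1ℤ :- q :* a) :* (b :+ q :* a :* g)
             := (con 1ℤ :- q :* a) :* b :+ q :* (a :* ((con 1ℤ :- q :* a) :* g))) refl q (q ^ m) β γ ⟩
      (1# - q * q ^ m) * β + q * (q ^ m * ((1# - q * q ^ m) * γ))
        ≈⟨ +-congˡ (*-congˡ (absorb′ n m)) ⟨
      (1# - q * q ^ m) * β + q * ((q ^ m - q ^ suc n) * β)
        ≈⟨ solve 4 (λ q a c b → (con 1ℤ :- q :* a) :* b :+ q :* ((a :- c) :* b) := (con 1ℤ :- q :* c) :* b) refl q (q ^ m) (q ^ suc n) β ⟩
      (1# - q ^ suc (suc n)) * β ∎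
      where
      β γ : Carrier
      β = qbinom (suc n) m
      γ = qbinom (suc n) (suc m)

    -- For m ≤ n + 1 this is (1 - q^(n+1-m)) [n+1,m] = (1 - q^(m+1)) [n+1,m+1] multiplied by q^m, a
    -- form free of subtraction in exponents.
    absorb′ : ∀ n m → (q ^ m - q ^ suc n) * qbinom (suc n) m ≈ q ^ m * ((1# - q ^ suc m) * qbinom (suc n) (suc m))
    absorb′ n zero    = sym (trans (*-congˡ (absorb n 0)) (*-identityˡ _))
    absorb′ n (suc m) = begin
      (a - c) * qbinom (suc n) (suc m)
        ≈⟨ solve 3 (λ a c b → (a :- c) :* b := (con 1ℤ :- c) :* b :- (con 1ℤ :- a) :* b) refl a c _ ⟩
      (1# - c) * qbinom (suc n) (suc m) - (1# - a) * qbinom (suc n) (suc m)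
        ≈⟨ +-cong (*-congˡ (pascal n m)) (-‿cong (absorb n m)) ⟩
      (1# - c) * (qbinom n m + a * qbinom n (suc m)) - (1# - c) * qbinom n m
        ≈⟨ solve 4 (λ a c b b′ → (con 1ℤ :- c) :* (b :+ a :* b′) :- (con 1ℤ :- c) :* b := a :* ((con 1ℤ :- c) :* b′)) refl a c (qbinom n m) (qbinom n (suc m)) ⟩
      a * ((1# - c) * qbinom n (suc m))
        ≈⟨ *-congˡ (absorb n (suc m)) ⟨
      a * ((1# - q ^ suc (suc m)) * qbinom (suc n) (suc (suc m))) ∎
      where
      a c : Carrier
      a = q ^ suc m
      c = q ^ suc n

  -- The coefficient of x^(m+1) in the recurrence for `H`. It follows from the Pascal rule by
  -- writing q^(m+1) as 1 - (1 - q^(m+1)) and absorbing the second factor.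
  qbinom-rec : ∀ n m → qbinom (suc (suc n)) (suc m)
    ≈ (qbinom (suc n) (suc m) + qbinom (suc n) m) - (1# - q ^ suc n) * qbinom n m
  qbinom-rec n m = begin
    qbinom (suc (suc n)) (suc m)
      ≈⟨ pascal (suc n) m ⟩
    qbinom (suc n) m + q ^ suc m * qbinom (suc n) (suc m)
      ≈⟨ solve 3 (λ b a g → b :+ a :* g := (g :+ b) :- (con 1ℤ :- a) :* g) refl _ (q ^ suc m) _ ⟩
    (qbinom (suc n) (suc m) + qbinom (suc n) m) - (1# - q ^ suc m) * qbinom (suc n) (suc m)
      ≈⟨ +-congˡ (-‿cong (absorb n m)) ⟩
    (qbinom (suc n) (suc m) + qbinom (suc n) m) - (1# - q ^ suc n) * qbinom n m ∎

  qbinom-> : ∀ n m → n ℕ.< m → qbinom n m ≈ 0#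
  qbinom-> zero    (suc m) _         = refl
  qbinom-> (suc n) (suc m) (s≤s n<m) = trans (pascal n m)
    (trans (+-cong (qbinom-> n m n<m) (*-congˡ (qbinom-> n (suc m) (ℕP.m<n⇒m<1+n n<m))))
           (solve 1 (λ a → con 0ℤ :+ a :* con 0ℤ := con 0ℤ) refl (q ^ suc m)))

  qbinom-diag : ∀ n → qbinom n n ≈ 1#
  qbinom-diag zero    = refl
  qbinom-diag (suc n) = trans (pascal n n)
    (trans (+-cong (qbinom-diag n) (*-congˡ (qbinom-> n (suc n) ℕP.≤-refl)))
           (solve 1 (λ a → con 1ℤ :+ a :* con 0ℤ := con 1ℤ) refl (q ^ suc n)))

-- Rogers-Szegő polynomials as solutions of the recurrence

module RogersSzego (φ : Poly) where
  open QBinomial using (q; qbinom-rec; qbinom->; qbinom-diag)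
  private
    module S = IntegerSolver ℤ[q]
    module T = IntegerSolver ℤ[q][x]
  open B
  open Algebra.Properties.Semiring.Exp semiring using (_^_)
  open W using (X; const; coef; coef-sub)
  open Recurrence ℤ[q][x] X (const q) (const φ) public

  coef-1+x : ∀ f m → coef ((1# + X) * f) (suc m) A.≈ coef f (suc m) A.+ coef f m
  coef-1+x f m = A.trans (W.at (trans (distribʳ f 1# X) (+-congʳ (*-identityˡ f))) (suc m))
    (A.trans (W.coef-⊞ f (X * f) (suc m)) (A.+-congˡ (W.at (W.X-* f) (suc m))))

  coef-1+x-0 : ∀ f → coef ((1# + X) * f) 0 A.≈ coef f 0
  coef-1+x-0 f = A.trans (W.at (trans (distribʳ f 1# X) (+-congʳ (*-identityˡ f))) 0)
    (A.trans (W.coef-⊞ f (X * f) 0) (A.trans (A.+-congˡ (W.at (W.X-* f) 0)) (A.+-identityʳ _)))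

  1-qⁿ : ∀ n → 1# - const q ^ n ≈ const (A.1# A.- q Â.^ n)
  1-qⁿ n = trans (+-congˡ (-‿cong (W.const-^ q n))) (sym (trans (W.const-+ _ _) (+-congˡ (W.const-neg _))))

  tail≈ : ∀ n f → X * (1# - const q ^ n) * f ≈ X * (const (A.1# A.- q Â.^ n) * f)
  tail≈ n f = trans (*-assoc X _ f) (*-congˡ (*-congʳ (1-qⁿ n)))

  coef-H : ∀ n m → coef (H n) m A.≈ qbinom n m
  coef-H zero zero = A.refl
  coef-H zero (suc m) = A.refl
  coef-H (suc zero) zero = A.trans (W.coef-⊞ 1# X 0) (A.+-identityʳ _)
  coef-H (suc zero) (suc zero) = A.trans (W.coef-⊞ 1# X 1) (A.trans (A.+-identityˡ _) (A.sym (qbinom-diag 1)))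
  coef-H (suc zero) (suc (suc m)) = A.trans (W.coef-⊞ 1# X (suc (suc m))) (A.trans (A.+-identityˡ _)
    (A.sym (qbinom-> 1 (suc (suc m)) (s≤s (s≤s z≤n)))))
  coef-H (suc (suc n)) zero = A.trans (coef-sub ((1# + X) * H (suc n)) (X * (1# - const q ^ suc n) * H n) 0)
    (A.trans (A.+-cong (A.trans (coef-1+x-0 (H (suc n))) (coef-H (suc n) 0))
                       (A.-‿cong (A.trans (W.at (tail≈ (suc n) (H n)) 0) (W.at (W.X-* (const (A.1# A.- q Â.^ suc n) * H n)) 0))))
             (S.solve 1 (λ a → a S.:- S.con 0ℤ S.:= a) A.refl A.1#))
  coef-H (suc (suc n)) (suc m) = A.trans (coef-sub ((1# + X) * H (suc n)) (X * (1# - const q ^ suc n) * H n) (suc m))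
    (A.trans (A.+-cong (A.trans (coef-1+x (H (suc n)) m) (A.+-cong (coef-H (suc n) (suc m)) (coef-H (suc n) m)))
                       (A.-‿cong (A.trans (W.at (tail≈ (suc n) (H n)) (suc m))
                                 (A.trans (W.at (W.X-* (const (A.1# A.- q Â.^ suc n) * H n)) (suc m))
                                 (A.trans (W.coef-const* _ (H n) m) (A.*-congˡ (coef-H n m)))))))
             (A.sym (qbinom-rec n m)))

  -- The end coefficients are both 1 and are cancelled by 1 + X^(N+1). Those between are multiples
  -- of `φ` by hypothesis and those beyond vanish, so the difference can be divided coefficientwise.
  H-top : ∀ N → (∀ m → m ℕ.< N → ∃ λ h → qbinom (suc N) (suc m) A.≈ φ A.* h) →
    ∃ λ w → H (suc N) ≈ (1# + X ^ suc N) + const φ * w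
  H-top N p with W.coefs-divisible φ (H (suc N) - (1# + X ^ suc N)) div
    where
    split : ∀ i → coef (H (suc N) - (1# + X ^ suc N)) i A.≈ qbinom (suc N) i A.- (coef 1# i A.+ coef (X ^ suc N) i)
    split i = A.trans (coef-sub (H (suc N)) (1# + X ^ suc N) i)
      (A.+-cong (coef-H (suc N) i) (A.-‿cong (W.coef-⊞ 1# (X ^ suc N) i)))

    div : ∀ i → ∃ λ h → coef (H (suc N) - (1# + X ^ suc N)) i A.≈ φ A.* h
    div zero = A.0# , A.trans (split 0) (A.trans (A.+-congˡ (A.-‿cong (A.+-congˡ (W.coef-X^-≢ (suc N) 0 λ ()))))
      (S.solve 1 (λ f → S.con 1ℤ S.:- (S.con 1ℤ S.:+ S.con 0ℤ) S.:= f S.:* S.con 0ℤ) A.refl φ))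
    div (suc i) with ℕP.<-cmp i N
    ... | tri< i<N i≢N _ with p i i<N
    ...   | h , eq = h , A.trans (split (suc i)) (A.trans (A.+-cong eq (A.-‿cong (A.+-congˡ (W.coef-X^-≢ (suc N) (suc i) λ e → i≢N (ℕP.suc-injective e)))))
      (S.solve 1 (λ f → f S.:- (S.con 0ℤ S.:+ S.con 0ℤ) S.:= f) A.refl _))
    div (suc i) | tri≈ _ ≡.refl _ = A.0# , A.trans (split (suc i))
      (A.trans (A.+-cong (qbinom-diag (suc i)) (A.-‿cong (A.+-congˡ (W.coef-X^ (suc i)))))
      (S.solve 1 (λ f → S.con 1ℤ S.:- (S.con 0ℤ S.:+ S.con 1ℤ) S.:= f S.:* S.con 0ℤ) A.refl φ))
    div (suc i) | tri> _ i≢N i>N = A.0# , A.trans (split (suc i))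
      (A.trans (A.+-cong (qbinom-> (suc N) (suc i) (s≤s i>N)) (A.-‿cong (A.+-congˡ (W.coef-X^-≢ (suc N) (suc i) λ e → i≢N (ℕP.suc-injective e)))))
      (S.solve 1 (λ f → S.con 0ℤ S.:- (S.con 0ℤ S.:+ S.con 0ℤ) S.:= f S.:* S.con 0ℤ) A.refl φ))
  ... | w , eq = w , trans (T.solve 2 (λ h y → h T.:= y T.:+ (h T.:- y)) refl (H (suc N)) (1# + X ^ suc N)) (+-congˡ eq)

-- Cyclotomic polynomials

module Monic where
  open CommutativeRing ℤ[q]
  open IntegerSolver ℤ[q]
  open Algebra.Properties.Semiring.Exp semiring using (_^_; ^-homo-*)
  open import Relation.Binary.Reasoning.Setoid setoid
  open Q using (coef; coef-sub; const; X; const-0; const-neg; const-+; ∷-split; ⊠-split; ∷≋[])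

  coef-∷-* : ∀ a f g i → coef ((a ∷ f) * g) (suc i) ≡ a ℤ.* coef g (suc i) ℤ.+ coef (f * g) i
  coef-∷-* a f g i = ≡.trans (Q.coef-⊠ (a ∷ f) g (suc i)) (≡.cong (λ k → a ℤ.* coef g (suc i) ℤ.+ k) (≡.sym (Q.coef-⊠ f g i)))

  -- A notion of degree insensitive to trailing zeros. The value `b` may be 0, so `s` is the exact
  -- degree only once `b` is known to be nonzero.
  record Lead (f : Poly) (s : ℕ) (b : ℤ) : Set where
    constructor lead
    field
      top   : coef f s ≡ b
      above : ∀ i → s ℕ.< i → coef f i ≡ 0ℤ
  open Lead

  lead-cong : ∀ {f g s b} → f ≈ g → Lead f s b → Lead g s b
  lead-cong e (lead t a) = lead (≡.trans (≡.sym (at e _)) t) (λ i s<i → ≡.trans (≡.sym (at e i)) (a i s<i))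

  lead-tail : ∀ {a f s b} → Lead (a ∷ f) (suc s) b → Lead f s b
  lead-tail (lead t a) = lead t (λ i s<i → a (suc i) (s≤s s<i))

  lead-* : ∀ {f g s t a b} → Lead f s a → Lead g t b → Lead (f * g) (s ℕ.+ t) (a ℤ.* b)
  lead-* {[]} {g} (lead ≡.refl _) _ = lead (at (zeroˡ g) _) (λ i _ → at (zeroˡ g) i)
  lead-* {a ∷ f} {g} {zero} {t} (lead ≡.refl ab) (lead ≡.refl ab′) =
    lead (coef* t) (λ i t<i → ≡.trans (coef* i) (≡.trans (≡.cong (a ℤ.*_) (ab′ i t<i)) (ℤP.*-zeroʳ a)))
    where
    coef* : ∀ i → coef ((a ∷ f) * g) i ≡ a ℤ.* coef g i
    coef* i = ≡.trans (at (*-congʳ {g} {a ∷ f} {const a} (Q.∷-cong ≡.refl (coefwise λ j → ab (suc j) (s≤s z≤n)))) i) (Q.coef-const* a g i)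
  lead-* {a ∷ f} {g} {suc s} {t} p p′ with lead-* (lead-tail p) p′
  ... | lead t₁ ab = lead
      (≡.trans (coef-∷-* a f g (s ℕ.+ t)) (≡.trans (≡.cong₂ ℤ._+_ (zer (s ℕ.+ t) (ℕP.m≤n+m t s)) t₁) (ℤP.+-identityˡ _)))
      (λ { (suc i) (s≤s le) → ≡.trans (coef-∷-* a f g i) (≡.cong₂ ℤ._+_ (zer i (ℕP.≤-trans (ℕP.m≤n+m t s) (ℕP.<⇒≤ le))) (ab i le)) })
    where
    zer : ∀ i → t ℕ.≤ i → a ℤ.* coef g (suc i) ≡ 0ℤ
    zer i t≤i = ≡.trans (≡.cong (a ℤ.*_) (above p′ (suc i) (s≤s t≤i))) (ℤP.*-zeroʳ a)

  lead-unique : ∀ {f s t a b} → a ≢ 0ℤ → b ≢ 0ℤ → Lead f s a → Lead f t b → s ≡ t × a ≡ b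
  lead-unique {s = s} {t} a≢0 b≢0 p p′ with ℕP.<-cmp s t
  ... | tri< s<t _ _ = contradiction (≡.trans (≡.sym (top p′)) (above p t s<t)) b≢0
  ... | tri≈ _ ≡.refl _ = ≡.refl , ≡.trans (≡.sym (top p)) (top p′)
  ... | tri> _ _ t<s = contradiction (≡.trans (≡.sym (top p)) (above p′ s t<s)) a≢0

  1≢0 : 1ℤ ≢ 0ℤ
  1≢0 ()

  lead-of : ∀ f → f ≈ 0# ⊎ (∃₂ λ s b → b ≢ 0ℤ × Lead f s b)
  lead-of [] = inj₁ refl
  lead-of (a ∷ f) with lead-of f
  ... | inj₂ (s , b , b≢0 , lead t ab) = inj₂ (suc s , b , b≢0 , lead t (λ { (suc i) (s≤s le) → ab i le }))
  ... | inj₁ f≈0 with a ℤ.≟ 0ℤ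
  ...   | yes a≡0 = inj₁ (∷≋[] a≡0 f≈0)
  ...   | no a≢0 = inj₂ (0 , a , a≢0 , lead ≡.refl (λ { (suc i) _ → at f≈0 i }))

  -- Leading coefficients multiply, so that of `f` must be 1; in this way Φ_N inherits monicity from
  -- q^N - 1.
  monic-factor : ∀ {f g s n} → Lead g s 1ℤ → Lead (g * f) n 1ℤ → ∃ λ t → Lead f t 1ℤ
  monic-factor {f} {g} pg pgf with lead-of f
  ... | inj₁ f≈0 = contradiction (≡.trans (≡.sym (top pgf)) (at (trans (*-congˡ f≈0) (zeroʳ g)) _)) 1≢0
  ... | inj₂ (t , b , b≢0 , pf) with lead-* pg pf
  ...   | pgf′ rewrite ℤP.*-identityˡ b with lead-unique b≢0 1≢0 pgf′ pgf
  ...     | _ , ≡.refl = t , pf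

  -- The leading term of a nonzero `u` would survive in the product at some degree ≥ s. This is the
  -- uniqueness half of division with remainder.
  monic-cancel : ∀ {g s} → Lead g s 1ℤ → ∀ u → (∀ i → s ℕ.≤ i → coef (u * g) i ≡ 0ℤ) → u ≈ 0#
  monic-cancel pg [] _ = refl
  monic-cancel {g} {s} pg (a ∷ u) z = ∷≋[] (≡.trans (≡.sym (ℤP.*-identityʳ a)) (≡.trans (≡.cong (a ℤ.*_) (≡.sym (top pg))) (≡.trans (≡.sym (coef* s)) (z s ℕP.≤-refl)))) u≈0
    where
    u≈0 : u ≈ 0#
    u≈0 = monic-cancel pg u λ i s≤i → ≡.trans (≡.sym (ℤP.+-identityˡ _))
      (≡.trans (≡.cong (ℤ._+ coef (u * g) i) (≡.sym (≡.trans (≡.cong (a ℤ.*_) (above pg (suc i) (s≤s s≤i))) (ℤP.*-zeroʳ a))))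
      (≡.trans (≡.sym (coef-∷-* a u g i)) (z (suc i) (ℕP.m≤n⇒m≤1+n s≤i))))
    coef* : ∀ i → coef ((a ∷ u) * g) i ≡ a ℤ.* coef g i
    coef* i = ≡.trans (at (*-congʳ {g} {a ∷ u} {const a} (Q.∷-cong ≡.refl u≈0)) i) (Q.coef-const* a g i)

  divide : ∀ {g s} → Lead g s 1ℤ → ∀ f → ∃₂ λ u r → f ≈ u * g + r × (∀ i → s ℕ.≤ i → coef r i ≡ 0ℤ)
  divide {g} pg [] = 0# , 0# , sym (trans (+-identityʳ _) (zeroˡ g)) , λ _ _ → ≡.refl
  divide {g} {s} pg (a ∷ f) with divide pg f
  ... | u , r , eq , z = (t ∷ u) , (a ∷ r) - const t * g , eq′ , z′
    where
    t : ℤ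
    -- `a ∷ r` has degree at most `s`, since `r` vanishes from `s` on; subtracting t g clears
    -- precisely the coefficient at `s`.
    t = coef (a ∷ r) s
    eq′ : a ∷ f ≈ (t ∷ u) * g + ((a ∷ r) - const t * g)
    eq′ = begin
      a ∷ f                                                          ≈⟨ ∷-split a f ⟩
      const a + X * f                                                ≈⟨ +-congˡ (*-congˡ eq) ⟩
      const a + X * (u * g + r)                                      ≈⟨ solve 6 (λ a x u g r t → a :+ x :* (u :* g :+ r)
                                                                          := (t :* g :+ x :* (u :* g)) :+ ((a :+ x :* r) :- t :* g)) refl (const a) X u g r (const t) ⟩
      (const t * g + X * (u * g)) + ((const a + X * r) - const t * g) ≈⟨ +-cong (⊠-split t u g) (+-congʳ (∷-split a r)) ⟨
      (t ∷ u) * g + ((a ∷ r) - const t * g)                          ∎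
    cf : ∀ i → coef ((a ∷ r) - const t * g) i ≡ coef (a ∷ r) i ℤ.- t ℤ.* coef g i
    cf i = ≡.trans (coef-sub (a ∷ r) (const t * g) i) (≡.cong (λ k → coef (a ∷ r) i ℤ.- k) (Q.coef-const* t g i))
    z′ : ∀ i → s ℕ.≤ i → coef ((a ∷ r) - const t * g) i ≡ 0ℤ
    z′ i s≤i with ℕP.m≤n⇒m<n∨m≡n s≤i
    ... | inj₂ ≡.refl = ≡.trans (cf s) (≡.trans (≡.cong (λ k → t ℤ.- t ℤ.* k) (top pg)) (≡.trans (≡.cong (λ k → t ℤ.- k) (ℤP.*-identityʳ t)) (ℤP.+-inverseʳ t)))
    z′ (suc i) s≤i | inj₁ (s≤s s≤i′) = ≡.trans (cf (suc i)) (≡.cong₂ (λ k k′ → k ℤ.- k′) (z i s≤i′)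
      (≡.trans (≡.cong (t ℤ.*_) (above pg (suc i) (s≤s s≤i′))) (ℤP.*-zeroʳ t)))

  infix 4 _∣_
  _∣_ : Poly → Poly → Set
  f ∣ g = ∃ λ h → g ≈ f * h

  -- If ρ is the remainder of `f`, then r ρ is a multiple of `g` of degree below `s`, hence 0, and
  -- `r` can be cancelled in ℤ. This is the descent from ℚ to ℤ.
  monic-∣-cancel : ∀ {g s r} → Lead g s 1ℤ → r ≢ 0ℤ → ∀ f → g ∣ const r * f → g ∣ f
  monic-∣-cancel {g} {s} {r} pg r≢0 f (h , eq) with divide pg f
  ... | u , ρ , eq′ , z = u , trans eq′ (trans (+-congˡ ρ≈0) (trans (+-identityʳ _) (*-comm u g)))
    where
    key : (h - const r * u) * g ≈ const r * ρ
    key = begin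
      (h - const r * u) * g                     ≈⟨ solve 4 (λ h r u g → (h :- r :* u) :* g := g :* h :- r :* (u :* g)) refl h (const r) u g ⟩
      g * h - const r * (u * g)                 ≈⟨ +-congʳ (sym eq) ⟩
      const r * f - const r * (u * g)           ≈⟨ +-congʳ (*-congˡ eq′) ⟩
      const r * (u * g + ρ) - const r * (u * g) ≈⟨ solve 3 (λ r a b → r :* (a :+ b) :- r :* a := r :* b) refl (const r) (u * g) ρ ⟩
      const r * ρ                               ∎
    w≈0 : h - const r * u ≈ 0#
    w≈0 = monic-cancel pg _ λ i s≤i → ≡.trans (at key i)
      (≡.trans (Q.coef-const* r ρ i) (≡.trans (≡.cong (r ℤ.*_) (z i s≤i)) (ℤP.*-zeroʳ r)))
    rρ≈0 : const r * ρ ≈ 0#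
    rρ≈0 = trans (sym key) (trans (*-congʳ w≈0) (zeroˡ g))
    ρ≈0 : ρ ≈ 0#
    ρ≈0 = coefwise λ i → lem i (ℤP.i*j≡0⇒i≡0∨j≡0 r (≡.trans (≡.sym (Q.coef-const* r ρ i)) (at rρ≈0 i)))
      where
      lem : ∀ i → r ≡ 0ℤ ⊎ coef ρ i ≡ 0ℤ → coef ρ i ≡ 0ℤ
      lem i (inj₁ e) = contradiction e r≢0
      lem i (inj₂ e) = e

  -- dropZeros, divGo, subPref and derivGo are private in Defs; a metavariable solved by unification gives each a name.
  mutual
    dropZeros′ : List ℤ → List ℤ
    dropZeros′ = _

    normalizeP≡ : ∀ f → normalizeP f ≡ reverse (dropZeros′ (reverse f))
    -- Abstracting the surroundings leaves the metavariable applied to a variable, a pattern with a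
    -- unique solution.
    normalizeP≡ f with reverse {A = ℤ} | reverse f
    ... | rev | xs = ≡.refl {x = rev (dropZeros′ xs)}

  mutual
    divGo′ : List ℤ → ℕ → List ℤ → List ℤ
    divGo′ = _

    quotMonic≡ : ∀ f g a gs → reverse (normalizeP g) ≡ a ∷ gs →
      let F = reverse (normalizeP f) in quotMonic f g ≡ reverse (divGo′ gs (suc (length F ℕ.∸ suc (length gs))) F)
    quotMonic≡ f g a gs eq with reverse (normalizeP g)
    quotMonic≡ f g a gs ≡.refl | .(a ∷ gs) with reverse (normalizeP f)
    ... | F with suc (length F ℕ.∸ suc (length gs))
    ... | k with reverse {A = ℤ}
    ... | rev = ≡.refl {x = rev (divGo′ gs k F)}

  mutual
    subPref′ : List ℤ → List ℤ → List ℤ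
    subPref′ = _

    divGo≡ : ∀ gs k a r → divGo′ gs (suc k) (a ∷ r) ≡ a ∷ divGo′ gs k (subPref′ r (map (a ℤ.*_) gs))
    divGo≡ gs k a r with map (a ℤ.*_) gs
    ... | bs = ≡.refl {x = a ∷ divGo′ gs k (subPref′ r bs)}

  ++-snoc : ∀ f a → f ++ a ∷ [] ≈ f + const a * X ^ length f
  ++-snoc [] a = sym (trans (+-identityˡ _) (*-identityʳ _))
  ++-snoc (b ∷ f) a = begin
    b ∷ (f ++ a ∷ [])                             ≈⟨ ∷-split b _ ⟩
    const b + X * (f ++ a ∷ [])                   ≈⟨ +-congˡ (*-congˡ (++-snoc f a)) ⟩
    const b + X * (f + const a * X ^ length f)    ≈⟨ solve 5 (λ b x f a k → b :+ x :* (f :+ a :* k) := (b :+ x :* f) :+ a :* (x :* k)) refl (const b) X f (const a) _ ⟩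
    (const b + X * f) + const a * (X * X ^ length f) ≈⟨ +-congʳ (∷-split b f) ⟨
    (b ∷ f) + const a * X ^ suc (length f)        ∎

  reverse-∷ : ∀ a f → reverse (a ∷ f) ≈ reverse f + const a * X ^ length f
  reverse-∷ a f = trans (reflexive (ListP.unfold-reverse a f)) (trans (++-snoc (reverse f) a)
    (+-congˡ (*-congˡ (reflexive (≡.cong (X ^_) (ListP.length-reverse f))))))

  coef-length : ∀ f i → length f ℕ.≤ i → coef f i ≡ 0ℤ
  coef-length []      i       _         = ≡.refl
  coef-length (a ∷ f) (suc i) (s≤s le)  = coef-length f i le

  coef-reverse : ∀ f i → length f ℕ.≤ i → coef (reverse f) i ≡ 0ℤ
  coef-reverse f i le = coef-length (reverse f) i (≡.subst (ℕ._≤ i) (≡.sym (ListP.length-reverse f)) le)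

  lead-reverse : ∀ a f → Lead (reverse (a ∷ f)) (length f) a
  lead-reverse a f = lead
    (≡.trans (at (reverse-∷ a f) n) (≡.trans (Q.coef-⊞ (reverse f) (const a * X ^ n) n)
      (≡.trans (≡.cong₂ ℤ._+_ (coef-reverse f n ℕP.≤-refl) (≡.trans (Q.coef-const* a (X ^ n) n) (≡.cong (a ℤ.*_) (Q.coef-X^ n))))
        (≡.trans (ℤP.+-identityˡ _) (ℤP.*-identityʳ a)))))
    (λ i n<i → coef-reverse (a ∷ f) i n<i)
    where
    n : ℕ
    n = length f

  dropZeros-≈ : ∀ xs → reverse (dropZeros′ xs) ≈ reverse xs
  dropZeros-≈ []              = refl
  dropZeros-≈ (+ zero ∷ xs)   = trans (dropZeros-≈ xs) (sym (trans (reverse-∷ 0ℤ xs)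
    (trans (+-congˡ (trans (*-congʳ const-0) (zeroˡ _))) (+-identityʳ _))))
  dropZeros-≈ (+ suc n ∷ xs)  = refl
  dropZeros-≈ (-[1+ n ] ∷ xs) = refl

  dropZeros-head : ∀ xs {a ys} → dropZeros′ xs ≡ a ∷ ys → a ≢ 0ℤ
  dropZeros-head (+ zero ∷ xs)   eq     e = dropZeros-head xs eq e
  dropZeros-head (+ suc n ∷ xs)  ≡.refl ()
  dropZeros-head (-[1+ n ] ∷ xs) ≡.refl ()

  normalizeP-≈ : ∀ f → normalizeP f ≈ f
  normalizeP-≈ f = trans (reflexive (normalizeP≡ f)) (trans (dropZeros-≈ (reverse f)) (reflexive (ListP.reverse-involutive f)))

  normalizeP-head : ∀ f {a ys} → reverse (normalizeP f) ≡ a ∷ ys → a ≢ 0ℤ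
  normalizeP-head f eq = dropZeros-head (reverse f)
    (≡.trans (≡.sym (ListP.reverse-involutive _)) (≡.trans (≡.cong reverse (≡.sym (normalizeP≡ f))) eq))

  subPref-length : ∀ k r bs → length r ≡ k ℕ.+ length bs → length (subPref′ r bs) ≡ length r
  subPref-length k r       []       eq = ≡.refl
  subPref-length k []      (b ∷ bs) eq = contradiction (≡.trans eq (ℕP.+-suc k _)) λ ()
  subPref-length k (x ∷ r) (b ∷ bs) eq = ≡.cong suc (subPref-length k r bs (ℕP.suc-injective (≡.trans eq (ℕP.+-suc k _))))

  -- Both lists start with their highest coefficient and are aligned there, so `bs` is subtracted
  -- above the lowest `k` places of `r`.
  subPref-≈ : ∀ k r bs → length r ≡ k ℕ.+ length bs → reverse (subPref′ r bs) ≈ reverse r - X ^ k * reverse bs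
  subPref-≈ k r [] eq = solve 2 (λ r x → r := r :- x :* con 0ℤ) refl (reverse r) (X ^ k)
  subPref-≈ k []      (b ∷ bs) eq = contradiction (≡.trans eq (ℕP.+-suc k _)) λ ()
  subPref-≈ k (x ∷ r) (b ∷ bs) eq = begin
    reverse (x ℤ.- b ∷ subPref′ r bs)
      ≈⟨ reverse-∷ (x ℤ.- b) (subPref′ r bs) ⟩
    reverse (subPref′ r bs) + const (x ℤ.- b) * X ^ length (subPref′ r bs)
      ≈⟨ +-cong (subPref-≈ k r bs eq′) (*-cong (trans (const-+ x (ℤ.- b)) (+-congˡ (const-neg b)))
           (reflexive (≡.cong (X ^_) (≡.trans (subPref-length k r bs eq′) eq′)))) ⟩
    (reverse r - X ^ k * reverse bs) + (const x - const b) * X ^ (k ℕ.+ length bs)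
      ≈⟨ +-congˡ (*-congˡ (^-homo-* X k (length bs))) ⟩
    (reverse r - X ^ k * reverse bs) + (const x - const b) * (X ^ k * X ^ length bs)
      ≈⟨ solve 6 (λ r k b x c l → (r :- k :* b) :+ (x :- c) :* (k :* l) := (r :+ x :* (k :* l)) :- k :* (b :+ c :* l)) refl
           (reverse r) (X ^ k) (reverse bs) (const x) (const b) (X ^ length bs) ⟩
    (reverse r + const x * (X ^ k * X ^ length bs)) - X ^ k * (reverse bs + const b * X ^ length bs)
      ≈⟨ +-cong (trans (reverse-∷ x r) (+-congˡ (*-congˡ (trans (reflexive (≡.cong (X ^_) eq′)) (^-homo-* X k (length bs))))))
           (-‿cong (*-congˡ (reverse-∷ b bs))) ⟨
    reverse (x ∷ r) - X ^ k * reverse (b ∷ bs) ∎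
    where
    eq′ : length r ≡ k ℕ.+ length bs
    eq′ = ℕP.suc-injective (≡.trans eq (ℕP.+-suc k _))

  -- The invariant of long division, translated by `reverse` to lowest degree first. The number of
  -- steps `k` is exactly the excess length, so the remainder has the length of `gs`; the leading 1
  -- dropped from the divisor reappears in `1ℤ ∷ gs`.
  divGo-spec : ∀ gs k F → length F ≡ k ℕ.+ length gs → length (divGo′ gs k F) ≡ k ×
    (∃ λ r → length r ≡ length gs × reverse F ≈ reverse (divGo′ gs k F) * reverse (1ℤ ∷ gs) + reverse r)
  divGo-spec gs zero F eq = ≡.refl , F , eq , sym (trans (+-congʳ (zeroˡ _)) (+-identityˡ _))
  divGo-spec gs (suc k) (a ∷ r) eq with divGo-spec gs k (subPref′ r ags) (≡.trans len eqr)
    where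
    ags : List ℤ
    ags = map (a ℤ.*_) gs
    eqr : length r ≡ k ℕ.+ length gs
    eqr = ℕP.suc-injective eq
    len : length (subPref′ r ags) ≡ length r
    len = subPref-length k r ags (≡.trans eqr (≡.cong (k ℕ.+_) (≡.sym (ListP.length-map _ gs))))
  ... | eqk , ρ , eqρ , e = ≡.cong suc eqk , ρ , eqρ , (begin
    reverse (a ∷ r)
      ≈⟨ reverse-∷ a r ⟩
    reverse r + const a * X ^ length r
      ≈⟨ +-cong (solve 2 (λ r s → r := (r :- s) :+ s) refl (reverse r) (X ^ k * reverse ags)) (*-congˡ (trans (reflexive (≡.cong (X ^_) eqr)) (^-homo-* X k _))) ⟩
    ((reverse r - X ^ k * reverse ags) + X ^ k * reverse ags) + const a * (X ^ k * X ^ length gs)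
      ≈⟨ +-congʳ (+-cong (trans (sym (subPref-≈ k r ags eqr′)) e) (*-congˡ rev-ags)) ⟩
    ((reverse d * reverse (1ℤ ∷ gs) + reverse ρ) + X ^ k * (const a * reverse gs)) + const a * (X ^ k * X ^ length gs)
      ≈⟨ solve 7 (λ d g r k a gs s → ((d :* g :+ r) :+ k :* (a :* gs)) :+ a :* (k :* s)
           := (d :* g :+ a :* k :* (gs :+ con 1ℤ :* s)) :+ r) refl
           (reverse d) (reverse (1ℤ ∷ gs)) (reverse ρ) (X ^ k) (const a) (reverse gs) (X ^ length gs) ⟩
    (reverse d * reverse (1ℤ ∷ gs) + const a * X ^ k * (reverse gs + 1# * X ^ length gs)) + reverse ρ
      ≈⟨ +-congʳ (+-congˡ (*-cong (*-congˡ (reflexive (≡.cong (X ^_) eqk))) (reverse-∷ 1ℤ gs))) ⟨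
    (reverse d * reverse (1ℤ ∷ gs) + const a * X ^ length d * reverse (1ℤ ∷ gs)) + reverse ρ
      ≈⟨ +-congʳ (trans (sym (distribʳ _ _ _)) (*-congʳ (sym (reverse-∷ a d)))) ⟩
    reverse (a ∷ d) * reverse (1ℤ ∷ gs) + reverse ρ ∎)
    where
    ags d : List ℤ
    ags = map (a ℤ.*_) gs
    d = divGo′ gs k (subPref′ r ags)
    eqr : length r ≡ k ℕ.+ length gs
    eqr = ℕP.suc-injective eq
    eqr′ : length r ≡ k ℕ.+ length ags
    eqr′ = ≡.trans eqr (≡.cong (k ℕ.+_) (≡.sym (ListP.length-map _ gs)))
    rev-ags : reverse ags ≈ const a * reverse gs
    rev-ags = trans (reflexive (≡.sym (ListP.reverse-map (a ℤ.*_) gs))) (Q.scale-const a (reverse gs))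

  -- The true cofactor `h` and the computed quotient differ by a polynomial whose product with `g`
  -- is the remainder, of degree below `s`; by `monic-cancel` they agree.
  quotMonic-exact : ∀ {f g s} → Lead g s 1ℤ → ¬ f ≈ 0# → g ∣ f → f ≈ g * quotMonic f g
  quotMonic-exact {f} {g} {s} pg f≉0 (h , eq) = go (reverse (normalizeP g)) ≡.refl
    where
    F : List ℤ
    F = reverse (normalizeP f)
    revF : reverse F ≈ f
    revF = trans (reflexive (ListP.reverse-involutive _)) (normalizeP-≈ f)
    go : ∀ G → reverse (normalizeP g) ≡ G → f ≈ g * quotMonic f g
    go G eqG with trans (sym (normalizeP-≈ g)) (reflexive (≡.trans (≡.sym (ListP.reverse-involutive (normalizeP g))) (≡.cong reverse eqG)))
    go [] eqG | g≈ = contradiction (≡.trans (≡.sym (top pg)) (at g≈ s)) 1≢0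
    go (a ∷ gs) eqG | g≈ with lead-unique 1≢0 (normalizeP-head g eqG) (lead-cong g≈ pg) (lead-reverse a gs)
    ... | s≡ , ≡.refl = trans eq (trans (*-congˡ h≈) (*-congˡ (reflexive (≡.sym (quotMonic≡ f g a gs eqG)))))
      where
      -- This makes the truncated subtraction in the step count genuine: a dividend too short for
      -- `g` would force h = 0 and so f = 0.
      long : s ℕ.< length F
      long with s ℕ.<? length F
      ... | yes p = p
      ... | no ¬p = contradiction (trans eq (trans (*-congˡ h≈0) (zeroʳ g))) f≉0
        where
        h≈0 : h ≈ 0#
        h≈0 = monic-cancel pg h λ i s≤i → ≡.trans (at (trans (*-comm h g) (trans (sym eq) (sym revF))) i)
          (coef-reverse F i (ℕP.≤-trans (ℕP.≮⇒≥ ¬p) s≤i))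
      k : ℕ
      k = suc (length F ℕ.∸ suc (length gs))
      lenF : length F ≡ k ℕ.+ length gs
      lenF = ≡.trans (≡.sym (ℕP.m∸n+n≡m (≡.subst (λ t → suc t ℕ.≤ length F) s≡ long))) (ℕP.+-suc _ _)
      u : Poly
      u = reverse (divGo′ gs k F)
      h≈ : h ≈ u
      h≈ with divGo-spec gs k F lenF
      ... | _ , r , lenr , e = trans (solve 2 (λ h u → h := u :+ (h :- u)) refl h u) (trans (+-congˡ h-u≈0) (+-identityʳ u))
        where
        h-u≈0 : h - u ≈ 0#
        h-u≈0 = monic-cancel pg (h - u) λ i s≤i → ≡.trans (at (begin
            (h - u) * g                                          ≈⟨ solve 3 (λ h u g → (h :- u) :* g := g :* h :- u :* g) refl h u g ⟩
            g * h - u * g                                        ≈⟨ +-congʳ (trans (sym eq) (trans (sym revF) e)) ⟩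
            u * reverse (1ℤ ∷ gs) + reverse r - u * g            ≈⟨ +-congʳ (+-congʳ (*-congˡ g≈)) ⟨
            u * g + reverse r - u * g                            ≈⟨ solve 2 (λ a r → a :+ r :- a := r) refl (u * g) (reverse r) ⟩
            reverse r                                            ∎) i)
          (coef-reverse r i (≡.subst (ℕ._≤ i) (≡.trans s≡ (≡.sym lenr)) s≤i))

-- Exactness of the defining division, and Φ_N as a factor of q-binomials

module Cyclotomic where
  open CommutativeRing ℤ[q]
  open IntegerSolver ℤ[q]
  open Algebra.Properties.Semiring.Exp semiring using (_^_; ^-homo-*)
  open import Relation.Binary.Reasoning.Setoid setoid
  open Q using (coef-sub; const; const-*; const-+)
  open QBinomial using (q; shiftP≈; absorb)
  open Monic
  module ∂q = Q.ExtendDerivation (zeroDerivation ℤP.+-*-commutativeRing) 1#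
  open ∂q using (D)

  -- The extra factor `q` avoids the exponent n - 1.
  q*D[q^n] : ∀ n → q * D (q ^ n) ≈ const (+ n) * q ^ n
  q*D[q^n] zero = begin
    q * D 1#             ≈⟨ *-congˡ (Derivation.δ-1 ∂q.derivation) ⟩
    q * 0#               ≈⟨ zeroʳ q ⟩
    0#                   ≈⟨ zeroˡ 1# ⟨
    0# * 1#              ≈⟨ *-congʳ Q.const-0 ⟨
    const 0ℤ * 1#        ∎
  q*D[q^n] (suc n) = begin
    q * D (q * q ^ n)                     ≈⟨ *-congˡ (∂q.D-X* (q ^ n)) ⟩
    q * (1# * q ^ n + q * D (q ^ n))      ≈⟨ *-congˡ (+-congˡ (q*D[q^n] n)) ⟩
    q * (1# * q ^ n + const (+ n) * q ^ n) ≈⟨ solve 3 (λ q a k → q :* (con 1ℤ :* a :+ k :* a) := (con 1ℤ :+ k) :* (q :* a)) refl q (q ^ n) (const (+ n)) ⟩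
    (1# + const (+ n)) * q ^ suc n        ≈⟨ *-congʳ (const-+ 1ℤ (+ n)) ⟨
    const (+ suc n) * q ^ suc n           ∎

  ∣-refl : ∀ f → f ∣ f
  ∣-refl f = 1# , sym (*-identityʳ f)

  ∣-trans : ∀ {f g h} → f ∣ g → g ∣ h → f ∣ h
  ∣-trans {f} (u , e) (v , e′) = u * v , trans e′ (trans (*-congʳ e) (*-assoc f u v))

  ∣-respʳ : ∀ {f g h} → g ≈ h → f ∣ g → f ∣ h
  ∣-respʳ e (u , e′) = u , trans (sym e) e′

  ∣-respˡ : ∀ {f g h} → f ≈ g → f ∣ h → g ∣ h
  ∣-respˡ e (u , e′) = u , trans e′ (*-congʳ e)

  ∣-*ʳ : ∀ f g → f ∣ f * g
  ∣-*ʳ f g = g , refl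

  ∣-*ˡ : ∀ f g → g ∣ f * g
  ∣-*ˡ f g = f , *-comm f g

  ∣-*-mono : ∀ {f g f′ g′} → f ∣ f′ → g ∣ g′ → f * g ∣ f′ * g′
  ∣-*-mono {f} {g} (u , e) (v , e′) = u * v , trans (*-cong e e′)
    (solve 4 (λ f u g v → (f :* u) :* (g :* v) := (f :* g) :* (u :* v)) refl f u g v)

  -- Coprimality over ℚ, which is all that monic polynomials need: see monic-∣-cancel.
  Coprime : Poly → Poly → Set
  Coprime f g = ∃ λ r → r ≢ 0ℤ × (∃₂ λ u v → const r ≈ u * f + v * g)

  coprime-1 : ∀ f → Coprime f 1#
  coprime-1 f = 1ℤ , 1≢0 , 0# , 1# , solve 1 (λ f → con 1ℤ := con 0ℤ :* f :+ con 1ℤ :* con 1ℤ) refl f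

  coprime-resp : ∀ {f g h} → g ≈ h → Coprime f g → Coprime f h
  coprime-resp e (r , r≢0 , u , v , e′) = r , r≢0 , u , v , trans e′ (+-congˡ (*-congˡ e))

  coprime-∣ : ∀ {f g h} → h ∣ g → Coprime f g → Coprime f h
  coprime-∣ {f} {g} {h} (k , e) (r , r≢0 , u , v , e′) = r , r≢0 , u , v * k , trans e′ (+-congˡ (trans (*-congˡ e)
    (solve 3 (λ v h k → v :* (h :* k) := v :* k :* h) refl v h k)))

  coprime-* : ∀ {f g h} → Coprime f g → Coprime f h → Coprime f (g * h)
  coprime-* {f} {g} {h} (r , r≢0 , u , v , e) (r′ , r′≢0 , u′ , v′ , e′) =
    r ℤ.* r′ , rr′≢0 , u * u′ * f + u * v′ * h + v * g * u′ , v * v′ , (begin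
      const (r ℤ.* r′)                         ≈⟨ const-* r r′ ⟩
      const r * const r′                       ≈⟨ *-cong e e′ ⟩
      (u * f + v * g) * (u′ * f + v′ * h)      ≈⟨ solve 7 (λ u f v g u′ v′ h → (u :* f :+ v :* g) :* (u′ :* f :+ v′ :* h)
                                                    := (u :* u′ :* f :+ u :* v′ :* h :+ v :* g :* u′) :* f :+ v :* v′ :* (g :* h)) refl u f v g u′ v′ h ⟩
      (u * u′ * f + u * v′ * h + v * g * u′) * f + v * v′ * (g * h) ∎)
    where
    rr′≢0 : r ℤ.* r′ ≢ 0ℤ
    rr′≢0 e with ℤP.i*j≡0⇒i≡0∨j≡0 r e
    ... | inj₁ z = r≢0 z
    ... | inj₂ z = r′≢0 z

  coprime-∣-* : ∀ {f g h s} → Lead (f * g) s 1ℤ → Coprime f g → f ∣ h → g ∣ h → f * g ∣ h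
  coprime-∣-* {f} {g} {h} l (r , r≢0 , u , v , e) (a , e₁) (b , e₂) = monic-∣-cancel l r≢0 h (u * b + v * a , (begin
    const r * h                        ≈⟨ *-congʳ e ⟩
    (u * f + v * g) * h                ≈⟨ distribʳ h _ _ ⟩
    u * f * h + v * g * h              ≈⟨ +-cong (*-congˡ e₂) (*-congˡ e₁) ⟩
    u * f * (g * b) + v * g * (f * a)  ≈⟨ solve 6 (λ u f g b v a → u :* f :* (g :* b) :+ v :* g :* (f :* a) := f :* g :* (u :* b :+ v :* a)) refl u f g b v a ⟩
    f * g * (u * b + v * a)            ∎))

  coprime-∣-cancel : ∀ {f g h s} → Lead f s 1ℤ → Coprime f g → f ∣ g * h → f ∣ h
  coprime-∣-cancel {f} {g} {h} l (r , r≢0 , u , v , e) (k , e′) = monic-∣-cancel l r≢0 h (u * h + v * k , (begin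
    const r * h                  ≈⟨ *-congʳ e ⟩
    (u * f + v * g) * h          ≈⟨ solve 5 (λ u f v g h → (u :* f :+ v :* g) :* h := u :* f :* h :+ v :* (g :* h)) refl u f v g h ⟩
    u * f * h + v * (g * h)      ≈⟨ +-congˡ (*-congˡ e′) ⟩
    u * f * h + v * (f * k)      ≈⟨ solve 5 (λ u f h v k → u :* f :* h :+ v :* (f :* k) := f :* (u :* h :+ v :* k)) refl u f h v k ⟩
    f * (u * h + v * k)          ∎))

  -- F = q^N - 1 is separable, as q F' - N F = N; hence two factors of it are coprime.
  separable : ∀ n f g → f * g ∣ q ^ suc n - 1# → Coprime f g
  separable n f g (w , e) = + N , (λ ()) , q * D (g * w) - const (+ N) * (g * w) , q * D f * w , (begin
    const (+ N)
      ≈⟨ solve 2 (λ n a → n := n :* a :- n :* (a :- con 1ℤ)) refl (const (+ N)) (q ^ N) ⟩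
    const (+ N) * q ^ N - const (+ N) * F
      ≈⟨ +-cong (trans (sym (q*D[q^n] N)) (*-congˡ DF)) (-‿cong (*-congˡ e′)) ⟩
    q * (D f * (g * w) + f * D (g * w)) - const (+ N) * (f * (g * w))
      ≈⟨ solve 7 (λ q f′ g w f d n → q :* (f′ :* (g :* w) :+ f :* d) :- n :* (f :* (g :* w))
           := (q :* d :- n :* (g :* w)) :* f :+ q :* f′ :* w :* g) refl q (D f) g w f (D (g * w)) (const (+ N)) ⟩
    (q * D (g * w) - const (+ N) * (g * w)) * f + q * D f * w * g ∎)
    where
    N : ℕ
    N = suc n
    F : Poly
    F = q ^ N - 1#
    e′ : F ≈ f * (g * w)
    e′ = trans e (*-assoc f g w)
    DF : D (q ^ N) ≈ D f * (g * w) + f * D (g * w)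
    DF = begin
      D (q ^ N)                      ≈⟨ ∂q.D-cong (solve 1 (λ a → a := (a :- con 1ℤ) :+ con 1ℤ) refl (q ^ N)) ⟩
      D (F + 1#)                     ≈⟨ ∂q.D-+ F 1# ⟩
      D F + D 1#                     ≈⟨ +-cong (∂q.D-cong e′) (Derivation.δ-1 ∂q.derivation) ⟩
      D (f * (g * w)) + 0#           ≈⟨ trans (+-identityʳ _) (∂q.D-leibniz f (g * w)) ⟩
      D f * (g * w) + f * D (g * w)  ∎

  q^m-1∣q^bm-1 : ∀ m b → q ^ m - 1# ∣ q ^ (b ℕ.* m) - 1#
  q^m-1∣q^bm-1 m zero    = 0# , solve 1 (λ a → con 1ℤ :- con 1ℤ := a :* con 0ℤ) refl (q ^ m - 1#)
  q^m-1∣q^bm-1 m (suc b) with q^m-1∣q^bm-1 m b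
  ... | h , e = 1# + q ^ m * h , (begin
    q ^ (m ℕ.+ b ℕ.* m) - 1#                          ≈⟨ +-congʳ (^-homo-* q m (b ℕ.* m)) ⟩
    q ^ m * q ^ (b ℕ.* m) - 1#                        ≈⟨ solve 2 (λ a c → a :* c :- con 1ℤ := (a :- con 1ℤ) :+ a :* (c :- con 1ℤ)) refl (q ^ m) (q ^ (b ℕ.* m)) ⟩
    (q ^ m - 1#) + q ^ m * (q ^ (b ℕ.* m) - 1#)       ≈⟨ +-congˡ (*-congˡ e) ⟩
    (q ^ m - 1#) + q ^ m * ((q ^ m - 1#) * h)         ≈⟨ solve 2 (λ a h → (a :- con 1ℤ) :+ a :* ((a :- con 1ℤ) :* h) := (a :- con 1ℤ) :* (con 1ℤ :+ a :* h)) refl (q ^ m) h ⟩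
    (q ^ m - 1#) * (1# + q ^ m * h)                   ∎)

  ∣⇒q^-∣ : ∀ {m n} → m ℕD.∣ n → q ^ m - 1# ∣ q ^ n - 1#
  ∣⇒q^-∣ {m} (ℕD.divides b ≡.refl) = q^m-1∣q^bm-1 m b

  q^-difference : ∀ g {a b} → g ℕ.+ a ≡ b → q ^ g - 1# ≈ (q ^ b - 1#) - q ^ g * (q ^ a - 1#)
  q^-difference g {a} {b} e = begin
    q ^ g - 1#
      ≈⟨ solve 2 (λ g a → g :- con 1ℤ := (g :* a :- con 1ℤ) :- g :* (a :- con 1ℤ)) refl (q ^ g) (q ^ a) ⟩
    (q ^ g * q ^ a - 1#) - q ^ g * (q ^ a - 1#)
      ≈⟨ +-congʳ (+-congʳ (trans (sym (^-homo-* q g a)) (reflexive (≡.cong (q ^_) e)))) ⟩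
    (q ^ b - 1#) - q ^ g * (q ^ a - 1#) ∎

  -- A Bézout relation g + yn = xm between exponents becomes q^g - 1 = (q^(xm) - 1) - q^g (q^(yn) -
  -- 1), and the two brackets are multiples of q^m - 1 and q^n - 1.
  q^gcd-1 : ∀ m n → ∃₂ λ u v → q ^ gcd m n - 1# ≈ u * (q ^ m - 1#) + v * (q ^ n - 1#)
  q^gcd-1 m n = go (gcd m n) (Bézout.identity (gcd-GCD m n))
    where
    go : ∀ g → Bézout.Identity.Identity g m n → ∃₂ λ u v → q ^ g - 1# ≈ u * (q ^ m - 1#) + v * (q ^ n - 1#)
    go g (Bézout.Identity.+- x y e) with q^m-1∣q^bm-1 m x | q^m-1∣q^bm-1 n y
    ... | h , p | k , p′ = h , - (q ^ g) * k , trans (q^-difference g e) (trans (+-cong p (-‿cong (*-congˡ p′)))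
      (solve 5 (λ a h g b k → a :* h :- g :* (b :* k) := h :* a :+ (:- g) :* k :* b) refl (q ^ m - 1#) h (q ^ g) (q ^ n - 1#) k))
    go g (Bézout.Identity.-+ x y e) with q^m-1∣q^bm-1 m x | q^m-1∣q^bm-1 n y
    ... | h , p | k , p′ = - (q ^ g) * h , k , trans (q^-difference g e) (trans (+-cong p′ (-‿cong (*-congˡ p)))
      (solve 5 (λ a h g b k → b :* k :- g :* (a :* h) := (:- g) :* h :* a :+ k :* b) refl (q ^ m - 1#) h (q ^ g) (q ^ n - 1#) k))

  lead-q^-1 : ∀ n → Lead (q ^ suc n - 1#) (suc n) 1ℤ
  lead-q^-1 n = lead
    (≡.trans (coef-sub (q ^ suc n) 1# (suc n)) (≡.trans (≡.cong (ℤ._- 0ℤ) (Q.coef-X^ (suc n))) ≡.refl))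
    (λ { (suc i) lt → ≡.trans (coef-sub (q ^ suc n) 1# (suc i)) (≡.cong (ℤ._- 0ℤ) (Q.coef-X^-≢ (suc n) (suc i) (λ e → ℕP.<⇒≢ lt (≡.sym e)))) })

  opaque
    -- An opaque copy of `cyc`, which keeps type checking from unfolding the table and the long
    -- divisions.
    Φ : ℕ → Poly
    Φ = cyc

    -- The product of Φ_i over the divisors i ≤ e of `N`; the bound `e` serves as the induction
    -- variable.
    T : ℕ → ℕ → Poly
    T N e = prodDivisors N (cycTable e)

    Φ≡ : ∀ n → Φ n ≡ cyc n
    Φ≡ n = ≡.refl

    T-zero : ∀ N → T N 0 ≡ oneP
    T-zero N = ≡.refl

    -- The table grows at its end whereas the product is folded from its front, so the new factor
    -- has to be carried through the whole list.
    prodDivisors-snoc-yes : ∀ {N d} p → d ℕD.∣ N → ∀ t → prodDivisors N (t ++ (d , p) ∷ []) ≈ prodDivisors N t * p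
    prodDivisors-snoc-yes {N} {d} p d∣N [] with d ℕD.∣? N
    ... | yes _ = trans (reflexive (*P≡ p oneP)) (*-comm p 1#)
    ... | no ¬d = contradiction d∣N ¬d
    prodDivisors-snoc-yes {N} p d∣N ((e , r) ∷ t) with e ℕD.∣? N
    ... | no _  = prodDivisors-snoc-yes p d∣N t
    ... | yes _ = trans (reflexive (*P≡ r _)) (trans (*-congˡ (prodDivisors-snoc-yes p d∣N t))
      (trans (sym (*-assoc r _ p)) (*-congʳ (reflexive (≡.sym (*P≡ r _))))))

    prodDivisors-snoc-no : ∀ {N d} p → ¬ d ℕD.∣ N → ∀ t → prodDivisors N (t ++ (d , p) ∷ []) ≈ prodDivisors N t
    prodDivisors-snoc-no {N} {d} p d∤N [] with d ℕD.∣? N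
    ... | yes d∣N = contradiction d∣N d∤N
    ... | no _    = refl
    prodDivisors-snoc-no {N} p d∤N ((e , r) ∷ t) with e ℕD.∣? N
    ... | no _  = prodDivisors-snoc-no p d∤N t
    ... | yes _ = trans (reflexive (*P≡ r _)) (trans (*-congˡ (prodDivisors-snoc-no p d∤N t)) (reflexive (≡.sym (*P≡ r _))))

    T-yes : ∀ {N e} → suc e ℕD.∣ N → T N (suc e) ≈ T N e * Φ (suc e)
    T-yes {e = e} d = prodDivisors-snoc-yes (cyc (suc e)) d (cycTable e)

    T-no : ∀ {N e} → ¬ suc e ℕD.∣ N → T N (suc e) ≈ T N e
    T-no {e = e} d = prodDivisors-snoc-no (cyc (suc e)) d (cycTable e)

    qPow-1≈ : ∀ n → qPow n -P oneP ≈ q ^ n - 1#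
    qPow-1≈ n = trans (reflexive (≡.trans (+P≡ (qPow n) (negP oneP)) (≡.cong (λ f → qPow n + f) (negP≡ oneP))))
      (+-congʳ (trans (shiftP≈ n oneP) (*-identityʳ (q ^ n))))

    Φ-exact : ∀ n {s} → Lead (T (suc n) n) s 1ℤ → T (suc n) n ∣ q ^ suc n - 1# → q ^ suc n - 1# ≈ T (suc n) n * Φ (suc n)
    Φ-exact n l d = trans (sym (qPow-1≈ (suc n))) (quotMonic-exact l
      (λ F≈0 → 1≢0 (≡.trans (≡.sym (Lead.top (lead-q^-1 n))) (at (trans (sym (qPow-1≈ (suc n))) F≈0) (suc n))))
      (∣-respʳ (sym (qPow-1≈ (suc n))) d))

  T-divisor : ∀ {g N} → g ℕD.∣ N → ∀ e → T g e ∣ T N e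
  T-divisor {g} {N} g∣N zero = 1# , trans (reflexive (≡.trans (T-zero N) (≡.sym (T-zero g)))) (sym (*-identityʳ _))
  T-divisor {g} {N} g∣N (suc e) with suc e ℕD.∣? g | suc e ℕD.∣? N
  ... | yes d | yes d′ = ∣-respˡ (sym (T-yes d)) (∣-respʳ (sym (T-yes d′)) (∣-*-mono (T-divisor g∣N e) (∣-refl _)))
  ... | yes d | no d′  = contradiction (ℕD.∣-trans d g∣N) d′
  ... | no d  | yes d′ = ∣-respˡ (sym (T-no d)) (∣-respʳ (sym (T-yes d′)) (∣-trans (T-divisor g∣N e) (∣-*ʳ _ _)))
  ... | no d  | no d′  = ∣-respˡ (sym (T-no d)) (∣-respʳ (sym (T-no d′)) (T-divisor g∣N e))

  T-mono : ∀ N {e e′} → e ℕ.≤′ e′ → T N e ∣ T N e′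
  T-mono N ℕ.≤′-refl = ∣-refl _
  T-mono N {e} {suc e′} (ℕ.≤′-step le) with suc e′ ℕD.∣? N
  ... | yes d = ∣-respʳ (sym (T-yes d)) (∣-trans (T-mono N le) (∣-*ʳ _ _))
  ... | no d  = ∣-respʳ (sym (T-no d)) (T-mono N le)

  -- The content of the strong induction, for the index n + 1. The field `product` says that the
  -- division defining `cyc` leaves no remainder.
  record IsCyclotomic (n : ℕ) : Set where
    constructor isCyclotomic
    field
      degree  : ℕ
      monic   : Lead (Φ (suc n)) degree 1ℤ
      product : q ^ suc n - 1# ≈ T (suc n) n * Φ (suc n)

    product-self : q ^ suc n - 1# ≈ T (suc n) (suc n)
    product-self = trans product (sym (T-yes ℕD.∣-refl))

    Φ∣ : Φ (suc n) ∣ q ^ suc n - 1#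
    Φ∣ = ∣-respʳ (sym product) (∣-*ˡ _ _)
  open IsCyclotomic

  coprime-combination : ∀ {φ f g h} → Coprime φ f → (∃₂ λ a b → f ≈ a * g + b * h) → φ ∣ h → Coprime φ g
  coprime-combination {φ} {f} {g} {h} (r , r≢0 , u , v , e) (a , b , e′) (k , e″) = r , r≢0 , u + v * b * k , v * a , (begin
    const r                              ≈⟨ e ⟩
    u * φ + v * f                        ≈⟨ +-congˡ (*-congˡ (trans e′ (+-congˡ (*-congˡ e″)))) ⟩
    u * φ + v * (a * g + b * (φ * k))    ≈⟨ solve 7 (λ u c v a m b h → u :* c :+ v :* (a :* m :+ b :* (c :* h)) := (u :+ v :* b :* h) :* c :+ v :* a :* m) refl
                                              u φ v a g b k ⟩
    (u + v * b * k) * φ + v * a * g      ∎)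

  -- The gcd g of m and N is a proper divisor of N, so q^g - 1 divides the product of the earlier
  -- factors and Φ_N (q^g - 1) divides q^N - 1. Separability makes Φ_N coprime to q^g - 1, and the
  -- Bézout relation carries this over to q^m - 1 because Φ_N divides q^N - 1.
  coprime-q^m-1 : ∀ {n} → (∀ i → i ℕ.≤ n → IsCyclotomic i) → ∀ m → ¬ suc n ℕD.∣ m → Coprime (Φ (suc n)) (q ^ m - 1#)
  coprime-q^m-1 {n} all m n∤m = go (gcd m N) (gcd[m,n]∣m m N) (gcd[m,n]∣n m N) (q^gcd-1 m N)
    where
    N : ℕ
    N = suc n
    go : ∀ g → g ℕD.∣ m → g ℕD.∣ N → (∃₂ λ u v → q ^ g - 1# ≈ u * (q ^ m - 1#) + v * (q ^ N - 1#)) → Coprime (Φ N) (q ^ m - 1#)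
    go zero    g∣m g∣N b = contradiction (ℕD.0∣⇒≡0 g∣N) λ ()
    go (suc g) g∣m g∣N b = coprime-combination (separable n (Φ N) (q ^ suc g - 1#) Φ*q^g∣) b (Φ∣ (all n ℕP.≤-refl))
      where
      g<n : g ℕ.< n
      g<n = ℕP.≤∧≢⇒< (ℕP.≤-pred (ℕD.∣⇒≤ g∣N)) (λ { ≡.refl → n∤m g∣m })
      q^g∣T : q ^ suc g - 1# ∣ T N n
      q^g∣T = ∣-respˡ (sym (product-self (all g (ℕP.<⇒≤ g<n)))) (∣-trans (T-divisor g∣N (suc g)) (T-mono N (ℕP.≤⇒≤′ g<n)))
      Φ*q^g∣ : Φ N * (q ^ suc g - 1#) ∣ q ^ N - 1#
      Φ*q^g∣ = ∣-respʳ (sym (trans (product (all n ℕP.≤-refl)) (*-comm _ _))) (∣-*-mono (∣-refl (Φ N)) q^g∣T)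

  module Step (n : ℕ) (all : ∀ i → i ℕ.< n → IsCyclotomic i) where
    N : ℕ
    N = suc n

    all≤ : ∀ {d} → d ℕ.< n → ∀ i → i ℕ.≤ d → IsCyclotomic i
    all≤ d<n i i≤d = all i (ℕP.≤-<-trans i≤d d<n)

    -- Each factor Φ_i has i ≤ d and divides q^i - 1, to which Φ_(d+1) is coprime since d + 1 cannot
    -- divide i.
    coprime-T : ∀ {d} → d ℕ.< n → ∀ e → e ℕ.≤ d → Coprime (Φ (suc d)) (T N e)
    coprime-T d<n zero    _   = coprime-resp (reflexive (≡.sym (T-zero N))) (coprime-1 _)
    coprime-T {d} d<n (suc e) e<d with suc e ℕD.∣? N
    ... | no ∤  = coprime-resp (sym (T-no ∤)) (coprime-T d<n e (ℕP.<⇒≤ e<d))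
    ... | yes ∣ = coprime-resp (sym (T-yes ∣)) (coprime-* (coprime-T d<n e (ℕP.<⇒≤ e<d))
      (coprime-∣ (Φ∣ (all≤ d<n e (ℕP.<⇒≤ e<d))) (coprime-q^m-1 (all≤ d<n) (suc e) (ℕD.>⇒∤ (s≤s e<d)))))

    -- Monic, pairwise coprime divisors of q^N - 1 have a product that still divides it. At e = n
    -- this is what exact long division requires.
    T-spec : ∀ e → e ℕ.≤ n → (∃ λ s → Lead (T N e) s 1ℤ) × T N e ∣ q ^ N - 1#
    T-spec zero _ rewrite T-zero N = (0 , lead ≡.refl (λ { (suc i) _ → ≡.refl })) , (_ , sym (*-identityˡ _))
    T-spec (suc e) e<n with T-spec e (ℕP.<⇒≤ e<n) | suc e ℕD.∣? N
    ... | (s , l) , p | no ∤  = (s , lead-cong (sym (T-no ∤)) l) , ∣-respˡ (sym (T-no ∤)) p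
    ... | (s , l) , p | yes ∣ = (_ , lead-cong (sym (T-yes ∣)) l′)
      , ∣-respˡ (trans (*-comm _ _) (sym (T-yes ∣))) (coprime-∣-* (lead-cong (*-comm _ _) l′) (coprime-T e<n e ℕP.≤-refl)
          (∣-trans (Φ∣ (all e e<n)) (∣⇒q^-∣ ∣)) p)
      where
      l′ : Lead (T N e * Φ (suc e)) _ 1ℤ
      l′ = lead-* l (monic (all e e<n))

    step : IsCyclotomic n
    step with T-spec n ℕP.≤-refl
    ... | (s , l) , d = isCyclotomic _ (proj₂ (monic-factor l (lead-cong prod (lead-q^-1 n)))) prod
      where
      prod : q ^ N - 1# ≈ T N n * Φ N
      prod = Φ-exact n l d

  cyclotomic-below : ∀ n i → i ℕ.< n → IsCyclotomic i
  cyclotomic-below (suc n) i (s≤s i≤n) = Step.step i λ j j<i → cyclotomic-below n j (ℕP.<-≤-trans j<i i≤n)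

  cyclotomic : ∀ n → IsCyclotomic n
  cyclotomic n = cyclotomic-below (suc n) n ℕP.≤-refl

  Φ∣1-q^ : ∀ n → Φ (suc n) ∣ 1# - q ^ suc n
  Φ∣1-q^ n with Φ∣ (cyclotomic n)
  ... | h , e = - h , trans (solve 1 (λ a → con 1ℤ :- a := :- (a :- con 1ℤ)) refl (q ^ suc n))
    (trans (-‿cong e) (solve 2 (λ a b → :- (a :* b) := a :* (:- b)) refl (Φ (suc n)) h))

  -- By `absorb` the product of q^(m+1) - 1 and the q-binomial is a multiple of 1 - q^N, hence of
  -- Φ_N, and Φ_N is coprime to the first factor because 0 < m + 1 < N.
  Φ∣qbinom : ∀ n m → m ℕ.< n → Φ (suc n) ∣ qbinom (suc n) (suc m)
  Φ∣qbinom n m m<n = coprime-∣-cancel (monic (cyclotomic n))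
    (coprime-q^m-1 (λ i _ → cyclotomic i) (suc m) (ℕD.>⇒∤ (s≤s m<n))) (∣-respʳ eq (∣-trans (Φ∣1-q^ n) (∣-*ʳ _ (- β′))))
    where
    β β′ : Poly
    β = qbinom (suc n) (suc m)
    β′ = qbinom n m
    eq : (1# - q ^ suc n) * - β′ ≈ (q ^ suc m - 1#) * β
    eq = begin
      (1# - q ^ suc n) * - β′        ≈⟨ solve 2 (λ a b → a :* (:- b) := :- (a :* b)) refl (1# - q ^ suc n) β′ ⟩
      - ((1# - q ^ suc n) * β′)      ≈⟨ -‿cong (absorb n m) ⟨
      - ((1# - q ^ suc m) * β)       ≈⟨ solve 2 (λ a b → :- ((con 1ℤ :- a) :* b) := (a :- con 1ℤ) :* b) refl (q ^ suc m) β ⟩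
      (q ^ suc m - 1#) * β           ∎

-- The operators and the functional

open QBinomial using (q; ^P≡; shiftP≈; qbinom->)
open Cyclotomic using (Φ; Φ≡; module ∂q; Φ∣qbinom; Φ∣1-q^)
open Monic using (normalizeP-≈)

module Operators where
  open B
  open W using (X; const; coef)
  -- `∂` differentiates in q with x held constant, hence x ↦ 0; `θ` is the Euler operator x d/dx,
  -- hence x ↦ x with constant coefficients.
  module ∂ = W.ExtendDerivation ∂q.derivation 0#
  module θ = W.ExtendDerivation (zeroDerivation ℤ[q]) X
  private module S = IntegerSolver ℤ[q]

  coef-+ : ∀ f g i → coef (f + g) i A.≈ coef f i A.+ coef g i
  coef-+ = W.coef-⊞

  coef-X*-0 : ∀ f → coef (X * f) 0 A.≈ A.0#
  coef-X*-0 f = W.at (W.X-* f) 0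

  coef-X*-suc : ∀ f i → coef (X * f) (suc i) A.≈ coef f i
  coef-X*-suc f i = W.at (W.X-* f) (suc i)

  coef-∂ : ∀ f i → coef (∂.D f) i A.≈ ∂q.D (coef f i)
  coef-∂ []      i       = A.refl
  coef-∂ (a ∷ f) zero    = A.trans (W.at (+-congʳ (trans (+-congˡ (zeroˡ f)) (+-identityʳ (const (∂q.D a))))) 0)
    (A.trans (coef-+ (const (∂q.D a)) (X * ∂.D f) 0) (A.trans (A.+-congˡ (coef-X*-0 (∂.D f))) (A.+-identityʳ _)))
  coef-∂ (a ∷ f) (suc i) = A.trans (W.at (+-congʳ (trans (+-congˡ (zeroˡ f)) (+-identityʳ (const (∂q.D a))))) (suc i))
    (A.trans (coef-+ (const (∂q.D a)) (X * ∂.D f) (suc i)) (A.trans (A.+-identityˡ _) (A.trans (coef-X*-suc (∂.D f) i) (coef-∂ f i))))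

  coef-θ : ∀ f i → coef (θ.D f) i A.≈ Q.const (+ i) A.* coef f i
  coef-θ []      i = A.sym (A.zeroʳ (Q.const (+ i)))
  coef-θ (a ∷ f) i = A.trans (W.at (trans (+-congʳ (trans (+-congʳ W.const-0) (+-identityˡ (X * f)))) (sym (distribˡ X f (θ.D f)))) i) (lem i)
    where
    lem : ∀ i → coef (X * (f + θ.D f)) i A.≈ Q.const (+ i) A.* coef (a ∷ f) i
    lem zero    = A.trans (coef-X*-0 (f + θ.D f)) (A.sym (A.trans (A.*-congʳ Q.const-0) (A.zeroˡ a)))
    lem (suc i) = A.trans (coef-X*-suc (f + θ.D f) i) (A.trans (coef-+ f (θ.D f) i) (A.trans (A.+-congˡ (coef-θ f i))
      (A.trans (S.solve 2 (λ f n → f S.:+ n S.:* f S.:= (S.con 1ℤ S.:+ n) S.:* f) A.refl (coef f i) (Q.const (+ i)))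
        (A.*-congʳ (A.sym (Q.const-+ 1ℤ (+ i)))))))

  coef-σ : ∀ u f i → coef (W.Substitution.σ (const u * X) f) i A.≈ u Â.^ i A.* coef f i
  coef-σ u [] i = A.sym (A.zeroʳ (u Â.^ i))
  coef-σ u (a ∷ f) i = A.trans (W.at (+-congˡ (trans (*-congʳ (*-comm (const u) X)) (*-assoc X (const u) (σ f)))) i)
    (A.trans (coef-+ (const a) (X * (const u * σ f)) i) (lem i))
    where
    open W.Substitution (const u * X)
    lem : ∀ i → coef (const a) i A.+ coef (X * (const u * σ f)) i A.≈ u Â.^ i A.* coef (a ∷ f) i
    lem zero    = A.trans (A.+-congˡ (coef-X*-0 (const u * σ f))) (A.trans (A.+-identityʳ a) (A.sym (A.*-identityˡ a)))
    lem (suc i) = A.trans (A.+-identityˡ _) (A.trans (coef-X*-suc (const u * σ f) i) (A.trans (W.coef-const* u (σ f) i)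
      (A.trans (A.*-congˡ (coef-σ u f i)) (A.sym (A.*-assoc u (u Â.^ i) (coef f i))))))

  iterate : (Carrier → Carrier) → ℕ → Carrier → Carrier
  iterate D zero    f = f
  iterate D (suc l) f = D (iterate D l f)

  -- The polynomial P in the operator `θ`, by Horner's rule. As x^i is an eigenvector of `θ` with
  -- eigenvalue i, it produces the factor P(i).
  P[θ] : Poly → Carrier → Carrier
  P[θ] []      f = 0#
  P[θ] (a ∷ P) f = const (Q.const a) * f + θ.D (P[θ] P f)

  coef-P[θ] : ∀ P f i → coef (P[θ] P f) i A.≈ Q.const (eval P (+ i)) A.* coef f i
  coef-P[θ] []      f i = A.sym (A.trans (A.*-congʳ Q.const-0) (A.zeroˡ _))
  coef-P[θ] (a ∷ P) f i = A.trans (coef-+ (const (Q.const a) * f) (θ.D (P[θ] P f)) i) (A.trans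
    (A.+-cong (W.coef-const* (Q.const a) f i) (A.trans (coef-θ (P[θ] P f) i) (A.*-congˡ (coef-P[θ] P f i))))
    (A.trans (S.solve 4 (λ a f n e → a S.:* f S.:+ n S.:* (e S.:* f) S.:= (a S.:+ n S.:* e) S.:* f) A.refl
        (Q.const a) (coef f i) (Q.const (+ i)) (Q.const (eval P (+ i))))
      (A.*-congʳ (A.sym (A.trans (Q.const-+ a (+ i ℤ.* eval P (+ i))) (A.+-congˡ (Q.const-* (+ i) (eval P (+ i)))))))))

  module _ (φ : Poly) (y : Carrier) where
    open Filtration ℤ[q][x] (const φ) y

    J-∂^ : ∀ l {a f} → J (l ℕ.* 2 ℕ.+ a) f → J a (iterate ∂.D l f)
    J-∂^ zero    p = p
    J-∂^ (suc l) {a} {f} p = J-δ₂ ∂.derivation (J-∂^ l (≡.subst (λ k → J k f) (eq l a) p))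
      where
      eq : ∀ l a → suc (suc (l ℕ.* 2 ℕ.+ a)) ≡ l ℕ.* 2 ℕ.+ suc (suc a)
      eq = solve-∀

    -- A list of at most n + 1 coefficients costs n units, one per effective use of `θ`: for the
    -- last entry Horner's rule applies `θ` to 0, at no cost.
    J-P[θ] : ∀ n P {a f} → length P ℕ.≤ suc n → J (n ℕ.+ a) f → J a (P[θ] P f)
    J-P[θ] n [] {a} {f} _ p = J-resp (zeroˡ f) (J-* 0# (J-weaken n p))
    J-P[θ] zero (c ∷ []) {f = f} le p = J-resp (sym (trans (+-congˡ (Derivation.δ-0 θ.derivation)) (+-identityʳ _))) (J-* (const (Q.const c)) p)
    J-P[θ] zero (c ∷ _ ∷ _) (s≤s ()) p
    J-P[θ] (suc n) (c ∷ P) {a} {f} (s≤s le) p = J-+ (J-* (const (Q.const c)) (J-weaken (suc n) p))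
      (J-δ₁ θ.derivation (trans (θ.D-const φ) W.const-0) (J-P[θ] n P le (≡.subst (λ k → J k f) (≡.sym (ℕP.+-suc n a)) p)))

-- The coefficient-list derivative as a derivation

module Derivative where
  open Q using (coef)

  mutual
    derivGo′ : ℕ → Poly → Poly
    derivGo′ = _

    deriv≡ : ∀ a f → deriv (a ∷ f) ≡ derivGo′ 1 f
    deriv≡ a f with 1
    ... | i = ≡.refl {x = derivGo′ i f}

  coef-derivGo : ∀ j f i → coef (derivGo′ j f) i ≡ + (j ℕ.+ i) ℤ.* coef f i
  coef-derivGo j []      i       = ≡.sym (ℤP.*-zeroʳ (+ (j ℕ.+ i)))
  coef-derivGo j (b ∷ f) zero    = ≡.cong (λ k → + k ℤ.* b) (≡.sym (ℕP.+-identityʳ j))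
  coef-derivGo j (b ∷ f) (suc i) = ≡.trans (coef-derivGo (suc j) f i) (≡.cong (λ k → + k ℤ.* coef f i) (≡.sym (ℕP.+-suc j i)))

  coef-deriv : ∀ f i → coef (deriv f) i ≡ + suc i ℤ.* coef f (suc i)
  coef-deriv []      i = ≡.sym (ℤP.*-zeroʳ (+ suc i))
  coef-deriv (a ∷ f) i = ≡.trans (≡.cong (λ g → coef g i) (deriv≡ a f)) (coef-derivGo 1 f i)

  eval-zero : ∀ {f} → f A.≈ A.0# → ∀ x → eval f x ≡ 0ℤ
  eval-zero {[]}    e x = ≡.refl
  eval-zero {a ∷ f} e x = ≡.trans (≡.cong₂ (λ b t → b ℤ.+ x ℤ.* t) (at e 0) (eval-zero (Q.[]-tail e) x))
    (≡.trans (ℤP.+-identityˡ _) (ℤP.*-zeroʳ x))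

  eval-cong : ∀ {f g} → f A.≈ g → ∀ x → eval f x ≡ eval g x
  eval-cong {[]}    {g}     e x = ≡.sym (eval-zero (A.sym e) x)
  eval-cong {a ∷ f} {[]}    e x = eval-zero e x
  eval-cong {a ∷ f} {b ∷ g} e x = ≡.cong₂ (λ b t → b ℤ.+ x ℤ.* t) (at e 0) (eval-cong (Q.∷-tail e) x)

  coef-D : ∀ f i → coef (∂q.D f) i ≡ + suc i ℤ.* coef f (suc i)
  coef-D []      i = ≡.sym (ℤP.*-zeroʳ (+ suc i))
  coef-D (a ∷ f) i = ≡.trans (at (A.+-congʳ (A.trans (A.+-cong Q.const-0 (A.*-identityˡ f)) (A.+-identityˡ f))) i)
    (≡.trans (Q.coef-⊞ f (Q.X A.* ∂q.D f) i) (lem i))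
    where
    lem : ∀ i → coef f i ℤ.+ coef (Q.X A.* ∂q.D f) i ≡ + suc i ℤ.* coef f i
    lem zero    = ≡.trans (≡.cong (λ k → coef f 0 ℤ.+ k) (at (Q.X-* (∂q.D f)) 0))
      (≡.trans (ℤP.+-identityʳ _) (≡.sym (ℤP.*-identityˡ _)))
    lem (suc i) = ≡.trans (≡.cong (λ k → coef f (suc i) ℤ.+ k) (≡.trans (at (Q.X-* (∂q.D f)) (suc i)) (coef-D f i)))
      (≡.trans (≡.cong (ℤ._+ + suc i ℤ.* coef f (suc i)) (≡.sym (ℤP.*-identityˡ (coef f (suc i))))) (≡.sym (ℤP.*-distribʳ-+ (coef f (suc i)) 1ℤ (+ suc i))))

  deriv≈ : ∀ f → deriv f A.≈ ∂q.D f
  deriv≈ f = coefwise λ i → ≡.trans (coef-deriv f i) (≡.sym (coef-D f i))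

  open Operators

  coef-∂^ : ∀ l f i p → W.coef f i A.≈ p → W.coef (iterate ∂.D l f) i A.≈ derivN l p
  coef-∂^ zero    f i p e = e
  coef-∂^ (suc l) f i p e = A.trans (coef-∂ (iterate ∂.D l f) i) (A.trans (∂q.D-cong (coef-∂^ l f i p e)) (A.sym (deriv≈ (derivN l p))))

  derivN-0 : ∀ l {p} → p A.≈ A.0# → derivN l p A.≈ A.0#
  derivN-0 zero    e = e
  derivN-0 (suc l) {p} e = A.trans (deriv≈ (derivN l p)) (∂q.D-zero {derivN l p} (derivN-0 l e))

-- The signed sum over a residue class as a linear functional

module Functional where
  open W using (X; const; coef)
  private module S = IntegerSolver ℤ[q]
  open import Relation.Binary.Reasoning.Setoid A.setoid

  -- The ℤ[q]-linear functional x^m ↦ ε m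
  L : (ℕ → ℤ) → B.Carrier → Poly
  L ε []      = A.0#
  L ε (a ∷ f) = Q.const (ε 0) A.* a A.+ L (λ i → ε (suc i)) f

  L-zero : ∀ ε {f} → f B.≈ B.0# → L ε f A.≈ A.0#
  L-zero ε {[]}    e = A.refl
  L-zero ε {a ∷ f} e = A.trans (A.+-cong (A.trans (A.*-congˡ (W.at e 0)) (A.zeroʳ (Q.const (ε 0)))) (L-zero (λ i → ε (suc i)) (W.[]-tail e))) (A.+-identityˡ _)

  L-cong : ∀ ε {f g} → f B.≈ g → L ε f A.≈ L ε g
  L-cong ε {[]}    {g}     e = A.sym (L-zero ε (B.sym e))
  L-cong ε {a ∷ f} {[]}    e = L-zero ε e
  L-cong ε {a ∷ f} {b ∷ g} e = A.+-cong (A.*-congˡ (W.at e 0)) (L-cong (λ i → ε (suc i)) (W.∷-tail e))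

  L-+ : ∀ ε f g → L ε (f B.+ g) A.≈ L ε f A.+ L ε g
  L-+ ε []      g       = A.trans (L-cong ε (B.+-identityˡ g)) (A.sym (A.+-identityˡ _))
  L-+ ε (a ∷ f) []      = A.trans (L-cong ε (B.+-identityʳ (a ∷ f))) (A.sym (A.+-identityʳ _))
  L-+ ε (a ∷ f) (b ∷ g) = A.trans (L-cong ε (W.∷-⊞ a b f g)) (A.trans (A.+-congˡ (L-+ (λ i → ε (suc i)) f g))
    (S.solve 5 (λ e a b u v → e S.:* (a S.:+ b) S.:+ (u S.:+ v) S.:= (e S.:* a S.:+ u) S.:+ (e S.:* b S.:+ v)) A.refl
      (Q.const (ε 0)) a b _ _))

  L-const* : ∀ ε a f → L ε (const a B.* f) A.≈ a A.* L ε f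
  L-const* ε a f = A.trans (L-cong ε (W.const-⊠ a f)) (go ε f)
    where
    go : ∀ ε f → L ε (W.scale a f) A.≈ a A.* L ε f
    go ε []      = A.sym (A.zeroʳ a)
    go ε (b ∷ f) = A.trans (A.+-congˡ (go (λ i → ε (suc i)) f))
      (S.solve 4 (λ e a b u → e S.:* (a S.:* b) S.:+ a S.:* u S.:= a S.:* (e S.:* b S.:+ u)) A.refl (Q.const (ε 0)) a b _)

  L-X^* : ∀ ε n f → L ε (X B̂.^ n B.* f) A.≈ L (λ i → ε (n ℕ.+ i)) f
  L-X^* ε zero    f = L-cong ε (B.*-identityˡ f)
  L-X^* ε (suc n) f = begin
    L ε (X B.* X B̂.^ n B.* f)                      ≈⟨ L-cong ε (B.trans (B.*-assoc X (X B̂.^ n) f) (W.X-* (X B̂.^ n B.* f))) ⟩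
    L ε (A.0# ∷ X B̂.^ n B.* f)                     ≈⟨ A.+-congʳ (A.zeroʳ (Q.const (ε 0))) ⟩
    A.0# A.+ L (λ i → ε (suc i)) (X B̂.^ n B.* f)   ≈⟨ A.+-identityˡ _ ⟩
    L (λ i → ε (suc i)) (X B̂.^ n B.* f)            ≈⟨ L-X^* (λ i → ε (suc i)) n f ⟩
    L (λ i → ε (suc n ℕ.+ i)) f                    ∎

  L-neg : ∀ ε ε′ f → (∀ i → ε′ i ≡ ℤ.- ε i) → L ε′ f A.≈ A.- L ε f
  L-neg ε ε′ []      e = S.solve 0 (S.con 0ℤ S.:= S.:- S.con 0ℤ) A.refl
  L-neg ε ε′ (a ∷ f) e = A.trans (A.+-cong (A.*-congʳ (A.trans (Q.const-cong (e 0)) (Q.const-neg (ε 0)))) (L-neg _ _ f (λ i → e (suc i))))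
    (S.solve 3 (λ e a u → (S.:- e) S.:* a S.:+ (S.:- u) S.:= S.:- (e S.:* a S.:+ u)) A.refl (Q.const (ε 0)) a _)

  -- Multiplication by X^N shifts the weights `ε` by N, and antiperiodicity turns the shift into a
  -- change of sign, so the two halves cancel.
  L-1+X^ : ∀ ε N → (∀ i → ε (N ℕ.+ i) ≡ ℤ.- ε i) → ∀ h → L ε ((B.1# B.+ X B̂.^ N) B.* h) A.≈ A.0#
  L-1+X^ ε N anti h = begin
    L ε ((B.1# B.+ X B̂.^ N) B.* h)            ≈⟨ L-cong ε (B.trans (B.distribʳ h B.1# (X B̂.^ N)) (B.+-congʳ (B.*-identityˡ h))) ⟩
    L ε (h B.+ X B̂.^ N B.* h)                 ≈⟨ L-+ ε h (X B̂.^ N B.* h) ⟩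
    L ε h A.+ L ε (X B̂.^ N B.* h)             ≈⟨ A.+-congˡ (A.trans (L-X^* ε N h) (L-neg ε (λ i → ε (N ℕ.+ i)) h anti)) ⟩
    L ε h A.- L ε h                           ≈⟨ A.-‿inverseʳ (L ε h) ⟩
    A.0#                                      ∎

  sum≈L : ∀ M ε (F : ℕ → Poly) f → (∀ i → F i A.≈ Q.const (ε i) A.* coef f i) →
    (∀ i → M ℕ.≤ i → coef f i A.≈ A.0#) → sumP (applyUpTo F M) A.≈ L ε f
  sum≈L zero    ε F f       e z = A.sym (L-zero ε {f} (W.coefwise λ i → z i z≤n))
  sum≈L (suc M) ε F []      e z = A.trans (A.reflexive (+P≡ (F 0) _)) (A.trans
    (A.+-cong (A.trans (e 0) (A.zeroʳ (Q.const (ε 0)))) (sum≈L M (λ i → ε (suc i)) (λ i → F (suc i)) [] (λ i → e (suc i)) (λ _ _ → A.refl))) (A.+-identityˡ _))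
  sum≈L (suc M) ε F (a ∷ f) e z = A.trans (A.reflexive (+P≡ (F 0) _))
    (A.+-cong (e 0) (sum≈L M (λ i → ε (suc i)) (λ i → F (suc i)) f (λ i → e (suc i)) (λ i le → z (suc i) (s≤s le))))

  ε : (c : ℕ) → .{{_ : ℕ.NonZero c}} → ℕ → ℕ → ℤ
  ε c j m = if ⌊ (m ℕ.% c) ℕ.≟ j ⌋ then signPow ((m ℕ.∸ j) ℕ./ c) else 0ℤ

  signPow-odd : ∀ k → k ℕ.% 2 ≡ 1 → ∀ t → signPow (t ℕ.+ k) ≡ ℤ.- signPow t
  signPow-odd (suc zero)    _   t = ≡.cong signPow (ℕP.+-comm t 1)
  signPow-odd (suc (suc k)) odd t = ≡.trans (≡.cong signPow (≡.trans (ℕP.+-suc t (suc k)) (≡.cong suc (ℕP.+-suc t k))))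
    (≡.trans (ℤP.neg-involutive _) (signPow-odd k odd t))

  -- Adding kc keeps the residue modulo c and raises (m - j)/c by the odd number k.
  ε-anti : ∀ c .{{_ : ℕ.NonZero c}} j k → k ℕ.% 2 ≡ 1 → ∀ m → ε c j (k ℕ.* c ℕ.+ m) ≡ ℤ.- ε c j m
  ε-anti c j k odd m rewrite ≡.trans (≡.cong (ℕ._% c) (ℕP.+-comm (k ℕ.* c) m)) (ℕM.[m+kn]%n≡m%n m k c) with (m ℕ.% c) ℕ.≟ j
  ... | no _  = ≡.refl
  ... | yes e = ≡.trans (≡.cong signPow eq) (signPow-odd k odd ((m ℕ.∸ j) ℕ./ c))
    where
    -- On the selected class j is the residue of m, so the truncated difference m - j is genuine.
    j≤m : j ℕ.≤ m
    j≤m = ≡.subst (ℕ._≤ m) e (ℕM.m%n≤m m c)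
    eq : (k ℕ.* c ℕ.+ m ℕ.∸ j) ℕ./ c ≡ (m ℕ.∸ j) ℕ./ c ℕ.+ k
    eq = ≡.trans (≡.cong (ℕ._/ c) (≡.trans (ℕP.+-∸-assoc (k ℕ.* c) j≤m) (ℕP.+-comm (k ℕ.* c) _)))
      (≡.trans (ℕM.+-distrib-/-∣ʳ (m ℕ.∸ j) (ℕD.n∣m*n k)) (≡.cong ((m ℕ.∸ j) ℕ./ c ℕ.+_) (ℕM.m*n/n≡m k c)))

-- Assembling the congruence

module Main (c k : ℕ) .{{_ : ℕ.NonZero c}} (odd : k ℕ.% 2 ≡ 1) (N : ℕ) (kc≡ : k ℕ.* c ≡ suc N) (d l z : ℕ) (P : Poly) (j n : ℕ)
  (n≥ : (deg P ℕ.+ 2 ℕ.* (l ℕ.+ d) ℕ.+ 1) ℕ.* suc N ℕ.≤ n) where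
  open B
  open W using (X; const; coef)
  open Operators
  open Derivative
  open Functional
  open RogersSzego (Φ (suc N)) using (H; H∈J; H-top; coef-H; 1-qⁿ)
  private
    module S = IntegerSolver ℤ[q]
    module T = IntegerSolver ℤ[q][x]
  open Algebra.Properties.Semiring.Exp semiring using (_^_)

  φ u : Poly
  φ = Φ (suc N)
  u = q Â.^ z

  y : Carrier
  y = 1# + X ^ suc N

  open Filtration ℤ[q][x] (const φ) y
  module σ = W.Substitution (const u * X)

  w : ℕ
  w = deg P ℕ.+ 2 ℕ.* (l ℕ.+ d) ℕ.+ 1

  J-H : J w (H n)
  J-H = go (Φ∣1-q^ N) (H-top N (Φ∣qbinom N))
    where
    go : (∃ λ ψ → A.1# A.- q Â.^ suc N A.≈ φ A.* ψ) → (∃ λ v → H (suc N) ≈ y + const φ * v) → J w (H n)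
    go (ψ , e) (v , e′) = ≡.subst (λ i → J w (H i)) (ℕP.m+[n∸m]≡n n≥)
      (H∈J y N (const ψ) v (trans (1-qⁿ (suc N)) (trans (W.const-cong e) (W.const-* φ ψ))) e′ w (n ℕ.∸ w ℕ.* suc N))

  σ-X^ : ∀ i → σ.σ (X ^ i) ≈ (const u * X) ^ i
  σ-X^ zero    = σ.σ-const A.1#
  σ-X^ (suc i) = trans (σ.σ-X* (X ^ i)) (*-congˡ (σ-X^ i))

  -- The substitution multiplies X^(N+1) by q^(z(N+1)), which is 1 modulo `φ`; hence the image of
  -- `y` is `y` plus a multiple of `φ`.
  J-σy : J 1 (σ.σ y)
  J-σy = go (Cyclotomic.∣-trans (Cyclotomic.IsCyclotomic.Φ∣ (Cyclotomic.cyclotomic N)) (Cyclotomic.q^m-1∣q^bm-1 (suc N) z))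
    where
    open import Relation.Binary.Reasoning.Setoid setoid
    open Algebra.Properties.CommutativeSemiring.Exp commutativeSemiring using (^-distrib-*)
    u^N : ∀ h → q Â.^ (z ℕ.* suc N) A.- A.1# A.≈ φ A.* h → u Â.^ suc N A.≈ A.1# A.+ φ A.* h
    u^N h e = A.trans (Â.^-assocʳ q z (suc N))
      (A.trans (S.solve 1 (λ a → a S.:= S.con 1ℤ S.:+ (a S.:- S.con 1ℤ)) A.refl (q Â.^ (z ℕ.* suc N))) (A.+-congˡ e))
    eq : ∀ h → u Â.^ suc N A.≈ A.1# A.+ φ A.* h → σ.σ y ≈ y + const φ * (const h * X ^ suc N)
    eq h e = begin
      σ.σ (1# + X ^ suc N)
        ≈⟨ trans (σ.σ-+ 1# (X ^ suc N)) (+-cong (σ.σ-const A.1#) (σ-X^ (suc N))) ⟩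
      1# + (const u * X) ^ suc N
        ≈⟨ +-congˡ (trans (^-distrib-* (const u) X (suc N)) (*-congʳ (W.const-^ u (suc N)))) ⟩
      1# + const (u Â.^ suc N) * X ^ suc N
        ≈⟨ +-congˡ (*-congʳ (trans (W.const-cong e) (trans (W.const-+ A.1# (φ A.* h)) (+-congˡ (W.const-* φ h))))) ⟩
      1# + (1# + const φ * const h) * X ^ suc N
        ≈⟨ T.solve 3 (λ f h x → T.con 1ℤ T.:+ (T.con 1ℤ T.:+ f T.:* h) T.:* x T.:= (T.con 1ℤ T.:+ x) T.:+ f T.:* (h T.:* x)) refl
             (const φ) (const h) (X ^ suc N) ⟩
      y + const φ * (const h * X ^ suc N) ∎
    go : (∃ λ h → q Â.^ (z ℕ.* suc N) A.- A.1# A.≈ φ A.* h) → J 1 (σ.σ y)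
    go (h , e) = J-resp (sym (eq h (u^N h e))) (J-+ (J-resp (*-identityʳ y) (J-y {f = 1#} J-all)) (J-φ₁ {const h * X ^ suc N}))

  -- `P` is normalised so that the number of Horner steps is governed by `deg P` and not by trailing
  -- zeros of the given list.
  G : Carrier
  G = P[θ] (normalizeP P) (σ.σ (iterate ∂.D l (H n)))

  J-G : J (suc (2 ℕ.* d)) G
  -- `deg` is the truncated length minus one, so the length is at most `suc (deg P)`, also for the
  -- zero polynomial.
  J-G = J-P[θ] φ y (deg P) (normalizeP P) (ℕP.m≤n+m∸n (length (normalizeP P)) 1)
    (J-hom σ.σ σ.σ-cong σ.σ-+ σ.σ-* (σ.σ-const φ) J-σy
      (J-∂^ φ y l (≡.subst (λ i → J i (H n)) (eq (deg P) l d) J-H)))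
    where
    eq : ∀ a l d → a ℕ.+ 2 ℕ.* (l ℕ.+ d) ℕ.+ 1 ≡ l ℕ.* 2 ℕ.+ (a ℕ.+ suc (2 ℕ.* d))
    eq = solve-∀

  coef-G : ∀ m → coef G m A.≈ Q.const (eval (normalizeP P) (+ m)) A.* (u Â.^ m A.* derivN l (qbinom n m))
  coef-G m = A.trans (coef-P[θ] (normalizeP P) _ m) (A.*-congˡ (A.trans (coef-σ u (iterate ∂.D l (H n)) m)
    (A.*-congˡ (coef-∂^ l (H n) m (qbinom n m) (coef-H n m)))))

  -- A copy of the summand local to `theSum`, definitionally equal to it, so that it can be named
  -- here.
  term : ℕ → Poly
  term m = if ⌊ (m ℕ.% c) ℕ.≟ j ⌋
           then scaleP (signPow ((m ℕ.∸ j) ℕ./ c) ℤ.* eval P (+ m))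
                       (shiftP (z ℕ.* m) (derivN l (qbinom n m)))
           else []

  term≈ : ∀ m → term m A.≈ Q.const (ε c j m) A.* coef G m
  term≈ m = A.trans (lem ⌊ (m ℕ.% c) ℕ.≟ j ⌋) (A.*-congˡ (A.sym (coef-G m)))
    where
    s : ℤ
    s = signPow ((m ℕ.∸ j) ℕ./ c)
    f : Poly
    f = derivN l (qbinom n m)
    lem : ∀ b → (if b then scaleP (s ℤ.* eval P (+ m)) (shiftP (z ℕ.* m) f) else [])
      A.≈ Q.const (if b then s else 0ℤ) A.* (Q.const (eval (normalizeP P) (+ m)) A.* (u Â.^ m A.* f))
    lem false = A.sym (A.trans (A.*-congʳ Q.const-0) (A.zeroˡ _))
    lem true = A.trans (Q.scale-const (s ℤ.* eval P (+ m)) (shiftP (z ℕ.* m) f)) (A.trans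
      (A.*-cong (A.trans (Q.const-* s (eval P (+ m))) (A.*-congˡ (Q.const-cong (≡.sym (eval-cong (normalizeP-≈ P) (+ m))))))
        (A.trans (shiftP≈ (z ℕ.* m) f) (A.*-congʳ (A.sym (Â.^-assocʳ q z m)))))
      (A.*-assoc _ _ _))

  theSum≈L : theSum c j l z P n A.≈ L (ε c j) G
  theSum≈L = A.trans (A.reflexive (≡.cong sumP (ListP.map-upTo term (suc n))))
    (sum≈L (suc n) (ε c j) term G term≈ λ i n<i → A.trans (coef-G i)
      (A.trans (A.*-congˡ (A.trans (A.*-congˡ (derivN-0 l (qbinom-> n i n<i))) (A.zeroʳ (u Â.^ i)))) (A.zeroʳ (Q.const _))))

  divisible : (cyc (suc N) ^P suc d) ∣P theSum c j l z P n
  divisible = go (J-decompose J-G (suc d) (ℕP.≤-reflexive (ℕP.*-suc 2 d)))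
    where
    open import Relation.Binary.Reasoning.Setoid A.setoid
    go : (∃₂ λ g h → G ≈ const φ ^ suc d * g + y * h) → (cyc (suc N) ^P suc d) ∣P theSum c j l z P n
    go (g , h , e) = L (ε c j) g , ≋⇒≈P (begin
      theSum c j l z P n
        ≈⟨ theSum≈L ⟩
      L (ε c j) G
        ≈⟨ L-cong (ε c j) e ⟩
      L (ε c j) (const φ ^ suc d * g + y * h)
        ≈⟨ L-+ (ε c j) (const φ ^ suc d * g) (y * h) ⟩
      L (ε c j) (const φ ^ suc d * g) A.+ L (ε c j) (y * h)
        ≈⟨ A.+-cong (A.trans (L-cong (ε c j) (*-congʳ (W.const-^ φ (suc d)))) (L-const* (ε c j) (φ Â.^ suc d) g))
             (L-1+X^ (ε c j) (suc N) (λ i → ≡.subst (λ r → ε c j (r ℕ.+ i) ≡ ℤ.- ε c j i) kc≡ (ε-anti c j k odd i)) h) ⟩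
      φ Â.^ suc d A.* L (ε c j) g A.+ A.0#
        ≈⟨ A.+-identityʳ _ ⟩
      φ Â.^ suc d A.* L (ε c j) g
        ≡⟨ ≡.cong (λ f → f Â.^ suc d A.* L (ε c j) g) (Φ≡ (suc N)) ⟩
      cyc (suc N) Â.^ suc d A.* L (ε c j) g
        ≡⟨ ≡.trans (*P≡ (cyc (suc N) ^P suc d) _) (≡.cong (A._* L (ε c j) g) (^P≡ (cyc (suc N)) (suc d))) ⟨
      (cyc (suc N) ^P suc d) *P L (ε c j) g ∎)

open import Data.Nat using (_+_; _*_; _%_; _≤_; _<_; NonZero)

theorem1p2 : (c k : ℕ) → .{{_ : NonZero c}} → 0 < k → k % 2 ≡ 1 →
    (d l z : ℕ) (P : Poly) (j : ℕ) → j < c →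
    (n : ℕ) → (deg P + 2 * (l + d) + 1) * k * c ≤ n →
    (cyc (k * c) ^P suc d) ∣P theSum c j l z P n
theorem1p2 c k 0<k odd d l z P j _ n n≥ = from-suc (k * c) ≡.refl (ℕP.m*n≢0 k c {{ℕ.>-nonZero 0<k}})
  where
  -- The product `k * c` is replaced by a variable so that it can be matched as a successor, the
  -- form in which the modulus is used above.
  from-suc : ∀ N → k * c ≡ N → NonZero N → (cyc N ^P suc d) ∣P theSum c j l z P n
  from-suc (suc N) eq _ = Main.divisible c k odd N eq d l z P j n
    (≡.subst (_≤ n) (≡.trans (ℕP.*-assoc (deg P + 2 * (l + d) + 1) k c) (≡.cong ((deg P + 2 * (l + d) + 1) *_) eq)) n≥)
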